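{- For a class $\mathcal C$ of graphs, the following are equivalent: (1) $\mathcal C$ has bounded clique-width; (2) $\sup_{G\in\mathcal C}\mathrm{mw}_\infty(G)<\infty$; (3) $\sup_{G\in\mathcal C}\mathrm{tmw}_\infty(G)<\infty$; (4) $\sup_{G\in\mathcal C}\mathrm{pmw}_\infty(G)<\infty$; (5) $\sup_{G\in\mathcal C}\mathrm{dmw}_\infty(G)<\infty$.
   Context: All graphs are finite, simple and undirected. For a partition $\mathcal P$ of $V(G)$ and $X\subseteq V(G)$, $X/\mathcal P$ denotes the set of parts of $\mathcal P$ that intersect $X$. For a set $R\subseteq\binom{V(G)}{2}$, $\mathrm{Ball}^r_R(v)$ is the set of vertices at distance at most $r$ from $v$ in $(V(G),R)$; similarly $\mathrm{Ball}^r_H(v)$ for a graph $H$. A partition $\mathcal P$ is homogeneous modulo $R$ if for all parts $X,Y\in\mathcal P$ (possibly equal), the pairs $\{x,y\}$ with $x\in X,y\in Y,x\ne y,\{x,y\}\notin R$ are all edges of $G$ or all non-edges. A merge sequence for $G$ is $(\mathcal P_1,R_1),\dots,(\mathcal P_m,R_m)$ with $\mathcal P_1\preceq\dots\preceq\mathcal P_m$ partitions of $V(G)$ (each coarser than or equal to the previous), $\mathcal P_1$ into singletons, $\mathcal P_m=\{V(G)\}$, $R_1\subseteq\dots\subseteq R_m\subseteq\binom{V(G)}2$, $\mathcal P_t$ homogeneous modulo $R_t$. Its radius-$r$ width is $\max_{1\le t<m}\max_v|\mathrm{Ball}^r_{R_{t+1}}(v)/\mathcal P_t|$; $\mathrm{mw}_r(G)$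 is its minimum. A $\mathcal P$-flip of $G$ is obtained by complementing adjacency between all pairs of distinct vertices of $X\times Y$ for some chosen pairs $(X,Y)$ of parts of $\mathcal P$ (possibly $X=Y$). $\mathrm{dist}_{\mathcal P}(x,y)=\max$ of $\mathrm{dist}_{G'}(x,y)$ over all $\mathcal P$-flips $G'$; $\mathrm{Ball}^r_{\mathcal P}(v)$ accordingly. $\mathcal N_S$ is the partition into atomic types over $S$: elements of $S$ are singletons and $u,v\notin S$ are in the same part iff $N(u)\cap S=N(v)\cap S$. $\mathrm{tmw}_r(G)$: least $k$ such that there is $(\mathcal P_1,G_1),\dots,(\mathcal P_m,G_m)$ with $\mathcal P_1\preceq\dots\preceq\mathcal P_m$ from singletons to $\{V(G)\}$, $G_i$ a $\mathcal P_i$-flip of $G$, and $|\mathrm{Ball}^r_{G_{i+1}}(v)/\mathcal P_i|\le k$ for all $i<m$, $v$. $\mathrm{pmw}_r(G)$: minimum over chains $\mathcal P_1\preceq\dots\preceq\mathcal P_m$ from singletons to $\{V(G)\}$ of $\max_{i<m}\max_v|\mathrm{Ball}^r_{\mathcal P_{i+1}}(v)/\mathcal P_i|$. $\mathrm{dmw}_r(G)$: minimum over total orders $v_1<\dots<v_n$ of $V(G)$ of $\max_{1\le i\le n}\max_v|\mathrm{Ball}^r_{\mathcal P_i}(v)/\mathcal P_i|$, where $\mathcal P_i=\mathcal N_{\{v_1,\dots,v_{n-i}\}}$. The radius-$\infty$ versions $\mathrm{mw}_\infty,\mathrm{tmw}_\infty,\mathrm{pmw}_\infty,\mathrm{dmw}_\infty$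 are defined identically but with $\mathrm{Ball}^\infty(v)=\bigcup_{r\ge1}\mathrm{Ball}^r(v)$ in place of $\mathrm{Ball}^r(v)$ (equivalently, taking $r\ge|V(G)|-1$). -}

module Defs where

open import Data.Nat using (ℕ; zero; suc; _+_; _∸_; _≤_; _<_; _<ᵇ_)
open import Data.Fin using (Fin; toℕ; splitAt; _≟_)
open import Data.Bool using (Bool; true; false; _∧_; _∨_; _xor_; if_then_else_)
open import Data.Sum using (_⊎_; inj₁; inj₂)
open import Data.Product using (Σ; ∃; _×_; _,_)
open import Data.Vec using (Vec; tabulate)
open import Data.Fin.Permutation using (Permutation′; _⟨$⟩ʳ_; _⟨$⟩ˡ_)
open import Relation.Nullary using (¬_)
open import Relation.Nullary.Decidable using (⌊_⌋)
open import Relation.Binary.PropositionalEquality using (_≡_; _≢_)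
open import Relation.Binary.Construct.Closure.ReflexiveTransitive using (Star)

record Graph (n : ℕ) : Set where
  field
    adj   : Fin n → Fin n → Bool
    sym   : ∀ x y → adj x y ≡ adj y x
    irref : ∀ x → adj x x ≡ false
open Graph public

Class : Set₁
Class = ∀ n → Graph n → Set

data Expr (k : ℕ) : ℕ → Set where
  empty   : Expr k 0
  vertex  : Fin k → Expr k 1
  union   : ∀ {m n} → Expr k m → Expr k n → Expr k (m + n)
  join    : ∀ {n} (i j : Fin k) → i ≢ j → Expr k n → Expr k n
  relabel : ∀ {n} (i j : Fin k) → Expr k n → Expr k n

_==_ : ∀ {k} → Fin k → Fin k → Bool
a == b = ⌊ a ≟ b ⌋

evalAdj : ∀ {k n} → Expr k n → Fin n → Fin n → Bool
evalLab : ∀ {k n} → Expr k n → Fin n → Fin k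

evalAdj empty x y = false
evalAdj (vertex i) x y = false
evalAdj (union {m} e₁ e₂) x y with splitAt m x | splitAt m y
... | inj₁ a | inj₁ b = evalAdj e₁ a b
... | inj₂ a | inj₂ b = evalAdj e₂ a b
... | _ | _ = false
evalAdj (join i j _ e) x y =
  evalAdj e x y ∨ ((evalLab e x == i ∧ evalLab e y == j) ∨ (evalLab e x == j ∧ evalLab e y == i))
evalAdj (relabel i j e) x y = evalAdj e x y

evalLab (vertex i) x = i
evalLab (union {m} e₁ e₂) x with splitAt m x
... | inj₁ a = evalLab e₁ a
... | inj₂ a = evalLab e₂ a
evalLab (join i j _ e) x = evalLab e x
evalLab (relabel i j e) x = if evalLab e x == i then j else evalLab e x

CW≤ : ℕ → ∀ {n} → Graph n → Set
CW≤ k {n} G = Σ (Expr k n) λ e → Σ (Permutation′ n) λ π →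
  ∀ x y → adj G (π ⟨$⟩ʳ x) (π ⟨$⟩ʳ y) ≡ evalAdj e x y

-- Partitions of Fin n, given by a labelling (x, y in the same part iff same label)

Singletons : ∀ {n} {L : Set} → (Fin n → L) → Set
Singletons p = ∀ x y → p x ≡ p y → x ≡ y

Whole : ∀ {n} {L : Set} → (Fin n → L) → Set
Whole p = ∀ x y → p x ≡ p y

_⪯_ : ∀ {n} {L : Set} → (Fin n → L) → (Fin n → L) → Set
p ⪯ q = ∀ x y → p x ≡ p y → q x ≡ q y

AtMostParts : ∀ {n} {L : Set} → ℕ → (Fin n → L) → (Fin n → Set) → Set
AtMostParts {n} {L} k p X = Σ (Fin k → L) λ f → ∀ x → X x → ∃ λ i → p x ≡ f i

Ball∞ : ∀ {n} → (Fin n → Fin n → Bool) → Fin n → Fin n → Set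
Ball∞ E v y = Star (λ a b → E a b ≡ true) v y

-- P-flip of G: F chooses (symmetrically) pairs of parts (by labels)
flipAdj : ∀ {n} {L : Set} → Graph n → (Fin n → L) → (L → L → Bool) → Fin n → Fin n → Bool
flipAdj G p F x y = if ⌊ x ≟ y ⌋ then false else (adj G x y xor (F (p x) (p y) ∨ F (p y) (p x)))

BallP∞ : ∀ {n} {L : Set} → Graph n → (Fin n → L) → Fin n → Fin n → Set
BallP∞ {L = L} G p v y = ∀ (F : L → L → Bool) → Ball∞ (flipAdj G p F) v y

-- mw_∞(G) ≤ k  (indices 0..m here correspond to 1..m+1 in the paper)

Homogeneous : ∀ {n} → Graph n → (Fin n → ℕ) → (Fin n → Fin n → Bool) → Set
Homogeneous G p R = ∀ x y x' y' → p x ≡ p x' → p y ≡ p y' → x ≢ y → x' ≢ y' →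
  R x y ≡ false → R x' y' ≡ false → adj G x y ≡ adj G x' y'

record MW∞≤ (k : ℕ) {n : ℕ} (G : Graph n) : Set where
  field
    m      : ℕ
    P      : ℕ → Fin n → ℕ
    R      : ℕ → Fin n → Fin n → Bool
    first  : Singletons (P 0)
    last   : Whole (P m)
    mono   : ∀ i → i < m → P i ⪯ P (suc i)
    Rsym   : ∀ i x y → R i x y ≡ R i y x
    Rmono  : ∀ i → i < m → ∀ x y → R i x y ≡ true → R (suc i) x y ≡ true
    homog  : ∀ i → i ≤ m → Homogeneous G (P i) (R i)
    width  : ∀ i → i < m → ∀ v → AtMostParts k (P i) (Ball∞ (R (suc i)) v)

-- tmw_∞(G) ≤ k  (G_i = flipAdj G (P i) (F i))

record TMW∞≤ (k : ℕ) {n : ℕ} (G : Graph n) : Set where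
  field
    m      : ℕ
    P      : ℕ → Fin n → ℕ
    F      : ℕ → ℕ → ℕ → Bool
    first  : Singletons (P 0)
    last   : Whole (P m)
    mono   : ∀ i → i < m → P i ⪯ P (suc i)
    width  : ∀ i → i < m → ∀ v →
             AtMostParts k (P i) (Ball∞ (flipAdj G (P (suc i)) (F (suc i))) v)

record PMW∞≤ (k : ℕ) {n : ℕ} (G : Graph n) : Set where
  field
    m      : ℕ
    P      : ℕ → Fin n → ℕ
    first  : Singletons (P 0)
    last   : Whole (P m)
    mono   : ∀ i → i < m → P i ⪯ P (suc i)
    width  : ∀ i → i < m → ∀ v → AtMostParts k (P i) (BallP∞ G (P (suc i)) v)

atomicTypes : ∀ {n} → Graph n → (Fin n → Bool) → Fin n → Fin n ⊎ Vec Bool n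
atomicTypes G S u = if S u then inj₁ u else inj₂ (tabulate λ s → S s ∧ adj G u s)

-- the total order: v_{j+1} = π ⟨$⟩ʳ j ; P_i = N_{ {v_1,…,v_{n-i}} }
orderPrefix : ∀ {n} → Permutation′ n → ℕ → Fin n → Bool
orderPrefix {n} π i u = toℕ (π ⟨$⟩ˡ u) <ᵇ (n ∸ i)

DMW∞≤ : ℕ → ∀ {n} → Graph n → Set
DMW∞≤ k {n} G = Σ (Permutation′ n) λ π → ∀ i → 1 ≤ i → i ≤ n → ∀ v →
  AtMostParts k (atomicTypes G (orderPrefix π i)) (BallP∞ G (atomicTypes G (orderPrefix π i)) v)

Bounded : (ℕ → ∀ {n} → Graph n → Set) → Class → Set
Bounded W C = ∃ λ k → ∀ n (G : Graph n) → C n G → W k G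

{-# OPTIONS --safe #-}
-- All parameters are compared with decompositions: binary trees whose nodes carry k labels such that
-- the labels at the two children determine the edges between them and the labels at the parent.
--
-- MW ⇒ TMW ⇒ PMW: if a partition is homogeneous modulo R, complementing the pairs of parts that are
-- complete outside R leaves only edges in R. DMW ⇒ PMW: adding w to S splits each part in at most three.
--
-- PMW ⇒ decomposition: let X meet at most k parts of P_i. If some P_i-flip disconnects X, split X along
-- it: edges across are determined by the parts. Otherwise X lies in a P_i-ball, hence meets at most k
-- parts of P_{i-1}, and one continues with i - 1.
--
-- Decomposition ⇒ MW: merge bottom-up, treating nodes of equal height in parallel.
--
-- Decomposition ⇒ DMW: a bounded set Q(A) of marked vertices is chosen in every node A, with
-- Q(A) ⊆ Q(l) ∪ Q(r) for the children l and r, and nodes are treated top-down, placing Q(l) and Q(r)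
-- next. When S contains representatives of all labels inside and outside A, adjacency across A is
-- determined by the types over S, except that a, a′ in A and y, y′ outside may satisfy a ≡ y′ and
-- a′ ≡ y while ay is an edge and a′y′ is not. To exclude this, Q(A) also contains, for all labels i
-- and j, either vertices of label i such that each vertex of label j has a non-neighbour among them,
-- or vertices of label j such that each vertex of label i has a neighbour among them. Sets of size
-- k + 2 with this property exist, and they can be taken from the children because only a bounded
-- amount of information about such a set matters from outside (Simulates). So A ∖ S is closed in a
-- flip, and since it has few types over S, so have the balls.
module Submission where

open import Defs
open import Data.Bool using (Bool; true; false; _∧_; _∨_; _xor_; not; if_then_else_)
import Data.Bool.Properties as Bool
open import Data.Empty using (⊥; ⊥-elim)
open import Data.Fin using (Fin; zero; suc; toℕ; fromℕ<; inject≤; _≟_; _↑ˡ_; _↑ʳ_; splitAt)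
open import Data.Fin using (combine; remQuot; opposite; funToFin; finToFun)
open import Data.Fin.Permutation using (Permutation; Permutation′; _⟨$⟩ʳ_; _⟨$⟩ˡ_; inverseˡ; inverseʳ; permutation; ↔⇒≡)
import Data.Fin.Properties as Fin
open import Data.Fin.Subset using (Subset)
open import Data.Fin.Subset.Properties using (anySubset?)
open import Data.List using (List; []; _∷_; _++_; length; filter; map; concat; drop; lookup; allFin)
open import Data.List using (cartesianProduct; cartesianProductWith)
import Data.List.Membership.DecPropositional as DecMembership
open import Data.List.Membership.Propositional using (_∈_; _∉_; find; lose)
open import Data.List.Membership.Propositional.Properties
open import Data.List.Properties using (length-++; length-filter; length-tabulate; filter-notAll; ++-identityʳ; ∷-injectiveʳ)
import Data.List.Relation.Unary.All as All
open import Data.List.Relation.Unary.AllPairs using ([]; _∷_)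
open import Data.List.Relation.Unary.Any as Any using (Any; here; there; index)
open import Data.List.Relation.Unary.Any.Properties using (lookup-index)
open import Data.List.Relation.Unary.Unique.Propositional using (Unique)
import Data.List.Relation.Unary.Unique.Propositional.Properties as Unique
open import Data.Nat using (ℕ; zero; suc; _+_; _*_; _∸_; _^_; _⊔_; _≤_; _<_; _<ᵇ_; _≤?_; z≤n; s≤s; s≤s⁻¹)
import Data.Nat.Properties as ℕ
open import Data.Product using (Σ; ∃; ∃₂; _×_; _,_; proj₁; proj₂; uncurry)
import Data.Product.Properties as Product
open import Data.Sum as Sum using (_⊎_; inj₁; inj₂; [_,_]′)
import Data.Sum.Properties as Sum
import Data.Vec as Vec
import Data.Vec.Properties as Vec
open import Function using (_∘_; id; case_of_)
open import Function.Bundles using (_⇔_; mk⇔; Equivalence)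
open import Function.Definitions using (Injective)
open import Level using (0ℓ)
open import Relation.Binary using (DecidableEquality)
open import Relation.Binary.Construct.Closure.ReflexiveTransitive using (ε; _◅_; _◅◅_; gmap)
open import Relation.Binary.PropositionalEquality renaming (sym to ≡-sym)
open import Relation.Nullary using (¬_; Dec; yes; no; contradiction)
open import Relation.Nullary.Decidable using (⌊_⌋; _×-dec_; _→-dec_; ¬?)
open import Relation.Unary using (Pred; Decidable)

-- Booleans, balls and numbers of parts

⌊⌋-true : {A : Set} (A? : Dec A) → ⌊ A? ⌋ ≡ true → A
⌊⌋-true (yes a) _ = a

true⇒⌊⌋ : {A : Set} (A? : Dec A) → A → ⌊ A? ⌋ ≡ true
true⇒⌊⌋ (yes _) _ = refl
true⇒⌊⌋ (no ¬a) a = contradiction a ¬a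

false≢true : ∀ {b} → b ≡ false → b ≡ true → ⊥
false≢true refl ()

≢true⇒false : ∀ {b} → ¬ b ≡ true → b ≡ false
≢true⇒false {false} _ = refl
≢true⇒false {true} h = contradiction refl h

⇔true⇒≡ : ∀ {a b} → (a ≡ true → b ≡ true) → (b ≡ true → a ≡ true) → a ≡ b
⇔true⇒≡ {true} f _ = ≡-sym (f refl)
⇔true⇒≡ {false} {true} _ g = g refl
⇔true⇒≡ {false} {false} _ _ = refl

∨-true : ∀ a {b} → a ∨ b ≡ true → a ≡ true ⊎ b ≡ true
∨-true true _ = inj₁ refl
∨-true false h = inj₂ h

∨-trueˡ : ∀ {a} b → a ≡ true → a ∨ b ≡ true
∨-trueˡ _ refl = refl

∨-trueʳ : ∀ a {b} → b ≡ true → a ∨ b ≡ true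
∨-trueʳ a refl = Bool.∨-zeroʳ a

stays : ∀ {n} {E : Fin n → Fin n → Bool} {C : Pred (Fin n) 0ℓ} →
  (∀ {a b} → C a → E a b ≡ true → C b) → ∀ {v y} → C v → Ball∞ E v y → C y
stays closed c ε = c
stays closed c (e ◅ es) = stays closed (closed c e) es

Ball-map : ∀ {n} {E E′ : Fin n → Fin n → Bool} →
  (∀ x y → E x y ≡ true → E′ x y ≡ true) → ∀ {v y} → Ball∞ E v y → Ball∞ E′ v y
Ball-map f = gmap id (λ {x} {y} → f x y)

AtMostParts-⊆ : ∀ {n} {L : Set} {k} {p : Fin n → L} {X Y : Fin n → Set} →
  (∀ {x} → Y x → X x) → AtMostParts k p X → AtMostParts k p Y
AtMostParts-⊆ Y⊆X (f , h) = f , λ x y → h x (Y⊆X y)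

codeParts : ∀ {n} {L : Set} {K} {p : Fin n → L} {X : Fin n → Set} (X? : Decidable X) →
  Fin n → (code : Fin n → Fin K) →
  (∀ {x x′} → X x → X x′ → code x ≡ code x′ → p x ≡ p x′) → AtMostParts K p X
codeParts {n} {L} {K} {p} {X} X? v code h = f , covers
  where
  witness? : ∀ i → Dec (∃ λ x → X x × code x ≡ i)
  witness? i = Fin.any? (λ x → X? x ×-dec (code x ≟ i))
  f : Fin K → L
  f i with witness? i
  ... | yes (x , _) = p x
  -- Codes not attained on `X` need some value; `v` supplies one.
  ... | no _ = p v
  covers : ∀ x → X x → ∃ λ i → p x ≡ f i
  covers x Xx = code x , eq
    where
    eq : p x ≡ f (code x)
    eq with witness? (code x)
    ... | yes (y , Xy , e) = h Xx Xy (≡-sym e)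
    ... | no ¬w = contradiction (x , Xx , refl) ¬w

-- Flips of a graph

flip-nonedge : ∀ {n} {L : Set} (G : Graph n) (p : Fin n → L) F {x y} →
  adj G x y ≡ F (p x) (p y) ∨ F (p y) (p x) → flipAdj G p F x y ≡ false
flip-nonedge G p F {x} {y} e with x ≟ y
... | yes _ = refl
... | no _ = trans (cong (_xor (F (p x) (p y) ∨ F (p y) (p x))) e) (Bool.xor-same (F (p x) (p y) ∨ F (p y) (p x)))

nonedge-flip : ∀ {n} {L : Set} (G : Graph n) (p : Fin n → L) F {x y} → x ≢ y →
  flipAdj G p F x y ≡ false → adj G x y ≡ F (p x) (p y) ∨ F (p y) (p x)
nonedge-flip G p F {x} {y} x≢y e with x ≟ y
... | yes x≡y = contradiction x≡y x≢y
... | no _ = xor-false (adj G x y) _ e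
  where
  xor-false : ∀ a b → a xor b ≡ false → a ≡ b
  xor-false true true _ = refl
  xor-false false b h = ≡-sym h

flipAdj-cong : ∀ {n} {L L′ : Set} (G : Graph n) (p : Fin n → L) (p′ : Fin n → L′) F F′ →
  (∀ x y → F (p x) (p y) ≡ F′ (p′ x) (p′ y)) → ∀ x y → flipAdj G p F x y ≡ flipAdj G p′ F′ x y
flipAdj-cong G p p′ F F′ eq x y =
  cong₂ (λ a b → if ⌊ x ≟ y ⌋ then false else (adj G x y xor (a ∨ b))) (eq x y) (eq y x)

flipAdj-irrefl : ∀ {n} {L : Set} (G : Graph n) (p : Fin n → L) F {x y} →
  flipAdj G p F x y ≡ true → x ≢ y
flipAdj-irrefl G p F {x} {y} e with x ≟ y
... | no ne = ne

-- The flip complements the pairs of parts that have an edge across C.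
closedInFlip : ∀ {n} {L : Set} (G : Graph n) {p : Fin n → L} → DecidableEquality L →
  {C : Pred (Fin n) 0ℓ} → Decidable C →
  (∀ {a a′ y y′} → C a → C a′ → ¬ C y → ¬ C y′ → p a ≡ p a′ → p y ≡ p y′ → adj G a y ≡ adj G a′ y′) →
  (∀ {a a′ y y′} → C a → C a′ → ¬ C y → ¬ C y′ → p a ≡ p y′ → p y ≡ p a′ → adj G a y ≡ adj G a′ y′) →
  ∀ {v y} → C v → BallP∞ G p v y → C y
closedInFlip {n} {L} G {p} _≟L_ {C} C? same swap Cv ball = stays closed Cv (ball F)
  where
  Crossing : L → L → Set
  Crossing τ σ = ∃ λ x → ∃ λ y → C x × ¬ C y × p x ≡ τ × p y ≡ σ × adj G x y ≡ true
  crossing? : ∀ τ σ → Dec (Crossing τ σ)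
  crossing? τ σ = Fin.any? λ x → Fin.any? λ y →
    C? x ×-dec ¬? (C? y) ×-dec (p x ≟L τ) ×-dec (p y ≟L σ) ×-dec (adj G x y Bool.≟ true)
  F : L → L → Bool
  F τ σ = ⌊ crossing? τ σ ⌋
  agrees : ∀ {a y} → C a → ¬ C y → adj G a y ≡ F (p a) (p y) ∨ F (p y) (p a)
  agrees {a} {y} Ca ¬Cy = ⇔true⇒≡
    (λ e → ∨-trueˡ _ (true⇒⌊⌋ (crossing? _ _) (a , y , Ca , ¬Cy , refl , refl , e)))
    λ e → case ∨-true (F (p a) (p y)) e of λ where
      (inj₁ f) → let (a′ , y′ , Ca′ , ¬Cy′ , pa , py , e′) = ⌊⌋-true (crossing? _ _) f
                 in trans (same Ca Ca′ ¬Cy ¬Cy′ (≡-sym pa) (≡-sym py)) e′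
      (inj₂ f) → let (a′ , y′ , Ca′ , ¬Cy′ , pa , py , e′) = ⌊⌋-true (crossing? _ _) f
                 in trans (swap Ca Ca′ ¬Cy ¬Cy′ (≡-sym py) (≡-sym pa)) e′
  closed : ∀ {a b} → C a → flipAdj G p F a b ≡ true → C b
  closed {a} {b} Ca e with C? b
  ... | yes Cb = Cb
  ... | no ¬Cb = ⊥-elim (false≢true (flip-nonedge G p F (agrees Ca ¬Cb)) e)

-- From merge sequences to flips

MW⇒TMW : ∀ {k n} {G : Graph n} → MW∞≤ k G → TMW∞≤ k G
MW⇒TMW {k} {n} {G} M = record
  { m = m ; P = P ; F = F ; first = first ; last = last ; mono = mono
  ; width = λ i i<m v → AtMostParts-⊆ (Ball-map (edge (suc i) i<m)) (width i i<m v) }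
  where
  open MW∞≤ M
  -- By homogeneity one edge outside `R` between two parts decides all pairs of these parts outside
  -- `R`, so a single witness is the right test.
  Joined : ℕ → ℕ → ℕ → Set
  Joined i a b = ∃ λ x → ∃ λ y → x ≢ y × P i x ≡ a × P i y ≡ b × R i x y ≡ false × adj G x y ≡ true
  joined? : ∀ i a b → Dec (Joined i a b)
  joined? i a b = Fin.any? λ x → Fin.any? λ y →
    ¬? (x ≟ y) ×-dec (P i x ℕ.≟ a) ×-dec (P i y ℕ.≟ b) ×-dec (R i x y Bool.≟ false) ×-dec (adj G x y Bool.≟ true)
  F : ℕ → ℕ → ℕ → Bool
  F i a b = ⌊ joined? i a b ⌋
  agrees : ∀ i → i ≤ m → ∀ {x y} → x ≢ y → R i x y ≡ false →
    adj G x y ≡ F i (P i x) (P i y) ∨ F i (P i y) (P i x)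
  agrees i i≤m {x} {y} x≢y r = ⇔true⇒≡
    (λ e → ∨-trueˡ _ (true⇒⌊⌋ (joined? i _ _) (x , y , x≢y , refl , refl , r , e)))
    λ e → case ∨-true (F i (P i x) (P i y)) e of λ where
      (inj₁ f) → let (x′ , y′ , ne , px , py , r′ , e′) = ⌊⌋-true (joined? i _ _) f
                 in trans (homog i i≤m x y x′ y′ (≡-sym px) (≡-sym py) x≢y ne r r′) e′
      -- `flipAdj` symmetrizes `F`, so the witnessing edge may have its ends in the opposite parts;
      -- symmetry of `R` and `G` turns it round.
      (inj₂ f) → let (x′ , y′ , ne , px , py , r′ , e′) = ⌊⌋-true (joined? i _ _) f
                 in trans (homog i i≤m x y y′ x′ (≡-sym py) (≡-sym px) x≢y (ne ∘ ≡-sym) r (trans (Rsym i y′ x′) r′))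
                      (trans (Graph.sym G y′ x′) e′)
  edge : ∀ i → i ≤ m → ∀ x y → flipAdj G (P i) (F i) x y ≡ true → R i x y ≡ true
  edge i i≤m x y e with R i x y in r
  ... | true = refl
  ... | false = ⊥-elim (false≢true
    (flip-nonedge G (P i) (F i) (agrees i i≤m (flipAdj-irrefl G (P i) (F i) e) r)) e)

TMW⇒PMW : ∀ {k n} {G : Graph n} → TMW∞≤ k G → PMW∞≤ k G
TMW⇒PMW M = record
  { m = m ; P = P ; first = first ; last = last ; mono = mono
  ; width = λ i i<m v → AtMostParts-⊆ (λ ball → ball (F (suc i))) (width i i<m v) }
  where open TMW∞≤ M

-- Atomic types and vertex orders

module _ {n : ℕ} where
  open DecMembership (_≟_ {n}) public using (_∈?_)

-- The value `zero` is reserved for everything outside the range of `f`; this makes the map total at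
-- the price of one label.
indexOf : ∀ {k} {L : Set} → DecidableEquality L → (Fin k → L) → L → Fin (suc k)
indexOf _≟L_ f a with Fin.any? (λ j → a ≟L f j)
... | yes (j , _) = suc j
... | no _ = zero

-- One argument in the range suffices: its index is a successor, so the other argument is found in
-- the range as well.
indexOf-injective : ∀ {k} {L : Set} (_≟L_ : DecidableEquality L) (f : Fin k → L) {a b} →
  (∃ λ j → a ≡ f j) → indexOf _≟L_ f a ≡ indexOf _≟L_ f b → a ≡ b
indexOf-injective _≟L_ f {a} {b} a∈f e
  with Fin.any? (λ j → a ≟L f j) | Fin.any? (λ j → b ≟L f j)
... | yes (j , a≡) | yes (j′ , b≡) = trans a≡ (trans (cong f (Fin.suc-injective e)) (≡-sym b≡))
... | yes _ | no _ = case e of λ ()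
... | no ¬a | _ = contradiction a∈f ¬a

module _ {n : ℕ} (G : Graph n) where

  sameType⁻ : ∀ S {x y} → atomicTypes G S x ≡ atomicTypes G S y →
    x ≡ y ⊎ (S x ≡ false × S y ≡ false × ∀ s → S s ≡ true → adj G x s ≡ adj G y s)
  sameType⁻ S {x} {y} e with S x | S y
  ... | true | true = inj₁ (Sum.inj₁-injective e)
  ... | false | false = inj₂ (refl , refl , λ s Ss → begin
      adj G x s          ≡⟨ cong (_∧ adj G x s) Ss ⟨
      S s ∧ adj G x s    ≡⟨ Vec.lookup∘tabulate (λ t → S t ∧ adj G x t) s ⟨
      Vec.lookup (Vec.tabulate λ t → S t ∧ adj G x t) s
                         ≡⟨ cong (λ v → Vec.lookup v s) (Sum.inj₂-injective e) ⟩
      Vec.lookup (Vec.tabulate λ t → S t ∧ adj G y t) s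
                         ≡⟨ Vec.lookup∘tabulate (λ t → S t ∧ adj G y t) s ⟩
      S s ∧ adj G y s    ≡⟨ cong (_∧ adj G y s) Ss ⟩
      adj G y s          ∎)
    where open ≡-Reasoning

  sameType⁺ : ∀ S {x y} → S x ≡ false → S y ≡ false →
    (∀ s → S s ≡ true → adj G x s ≡ adj G y s) → atomicTypes G S x ≡ atomicTypes G S y
  sameType⁺ S {x} {y} Sx Sy h rewrite Sx | Sy = cong inj₂ (Vec.tabulate-cong λ s → bit s (S s) refl)
    where
    bit : ∀ s b → S s ≡ b → b ∧ adj G x s ≡ b ∧ adj G y s
    bit s true e = h s e
    bit s false _ = refl

  sameType-S : ∀ S {x y} → S x ≡ true → atomicTypes G S x ≡ atomicTypes G S y → x ≡ y
  sameType-S S Sx e with sameType⁻ S e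
  ... | inj₁ x≡y = x≡y
  ... | inj₂ (Sx′ , _) = ⊥-elim (false≢true Sx′ Sx)

  sameType-adj : ∀ S {x y s} → S s ≡ true → atomicTypes G S x ≡ atomicTypes G S y → adj G x s ≡ adj G y s
  sameType-adj S Ss e with sameType⁻ S e
  ... | inj₁ refl = refl
  ... | inj₂ (_ , _ , h) = h _ Ss

  atomicTypes-mono : ∀ {S S′} → (∀ {s} → S′ s ≡ true → S s ≡ true) → atomicTypes G S ⪯ atomicTypes G S′
  atomicTypes-mono {S} {S′} S′⊆S x y e with sameType⁻ S e
  ... | inj₁ refl = refl
  ... | inj₂ (Sx , Sy , h) = sameType⁺ S′ (out Sx) (out Sy) (λ s S′s → h s (S′⊆S S′s))
    where
    out : ∀ {z} → S z ≡ false → S′ z ≡ false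
    out Sz = ≢true⇒false λ S′z → false≢true Sz (S′⊆S S′z)

_≟ᵗ_ : ∀ {n} → DecidableEquality (Fin n ⊎ Vec.Vec Bool n)
_≟ᵗ_ = Sum.≡-dec _≟_ (Vec.≡-dec Bool._≟_)

-- `PMW∞≤` takes labels in `ℕ`, so an abstract label is coded by a vertex that carries it, the same
-- one for its whole part.
module Encode {n : ℕ} {L : Set} (_≟L_ : DecidableEquality L) (p : Fin n → L) where

  firstWith : ∀ a → (∃ λ z → p z ≡ a) → Fin n
  firstWith a w with Fin.any? (λ z → p z ≟L a)
  ... | yes (z , _) = z
  ... | no ¬w = contradiction w ¬w

  firstWith-p : ∀ a w → p (firstWith a w) ≡ a
  firstWith-p a w with Fin.any? (λ z → p z ≟L a)
  ... | yes (z , e) = e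
  ... | no ¬w = contradiction w ¬w

  firstWith-irr : ∀ a w w′ → firstWith a w ≡ firstWith a w′
  firstWith-irr a w w′ with Fin.any? (λ z → p z ≟L a)
  ... | yes _ = refl
  ... | no ¬w = contradiction w ¬w

  encode : Fin n → ℕ
  encode x = toℕ (firstWith (p x) (x , refl))

  encode⁻ : ∀ {x y} → encode x ≡ encode y → p x ≡ p y
  encode⁻ {x} {y} e = trans (≡-sym (firstWith-p (p x) (x , refl)))
    (trans (cong p (Fin.toℕ-injective e)) (firstWith-p (p y) (y , refl)))

  encode⁺ : ∀ {x y} → p x ≡ p y → encode x ≡ encode y
  encode⁺ {x} {y} e = lemma e (x , refl) (y , refl)
    where
    lemma : ∀ {a b} → a ≡ b → ∀ w w′ → toℕ (firstWith a w) ≡ toℕ (firstWith b w′)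
    lemma refl w w′ = cong toℕ (firstWith-irr _ w w′)

  decode : Fin n → ℕ → L
  decode v a with a ℕ.<? n
  ... | yes a<n = p (fromℕ< a<n)
  ... | no _ = p v

  decode-encode : ∀ v x → decode v (encode x) ≡ p x
  decode-encode v x with encode x ℕ.<? n
  ... | yes a<n = trans (cong p (Fin.fromℕ<-toℕ _ a<n)) (firstWith-p (p x) (x , refl))
  ... | no ¬a = contradiction (Fin.toℕ<n _) ¬a

  -- A flip chosen on `L` is pulled back along `decode` to one chosen on codes; since the codes in
  -- use decode correctly, the graph is the same.
  BallP-encode : ∀ G {v y} → BallP∞ G encode v y → BallP∞ G p v y
  BallP-encode G {v} ball F = Ball-map
    (λ x y → trans (flipAdj-cong G p encode F F′
      (λ a b → ≡-sym (cong₂ F (decode-encode v a) (decode-encode v b))) x y))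
    (ball F′)
    where
    F′ : ℕ → ℕ → Bool
    F′ a b = F (decode v a) (decode v b)

<ᵇ⇒<′ : ∀ a b → (a <ᵇ b) ≡ true → a < b
<ᵇ⇒<′ a b e = ℕ.<ᵇ⇒< a b (Bool.T-≡ .Equivalence.from e)

<⇒<ᵇ′ : ∀ {a b} → a < b → (a <ᵇ b) ≡ true
<⇒<ᵇ′ {a} {b} h = Bool.T-≡ .Equivalence.to (ℕ.<⇒<ᵇ h)

module _ {n : ℕ} (π : Permutation′ n) where

  prefix-anti : ∀ i {s} → orderPrefix π (suc i) s ≡ true → orderPrefix π i s ≡ true
  prefix-anti i e = <⇒<ᵇ′ (ℕ.<-≤-trans (<ᵇ⇒<′ _ _ e) (ℕ.∸-monoʳ-≤ n (ℕ.n≤1+n i)))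

  -- Positions count from 0, so this is the only vertex in the prefix for `i` that is not in the
  -- prefix for `suc i`.
  newest : ∀ i → i < n → Fin n
  newest i i<n = π ⟨$⟩ʳ fromℕ< {n ∸ suc i} (ℕ.∸-monoʳ-< (s≤s z≤n) i<n)

  prefix-step : ∀ i (i<n : i < n) {s} → orderPrefix π i s ≡ true →
    orderPrefix π (suc i) s ≡ true ⊎ s ≡ newest i i<n
  prefix-step i i<n {s} e with ℕ.m≤n⇒m<n∨m≡n (s≤s⁻¹ (subst (toℕ (π ⟨$⟩ˡ s) <_) (ℕ.+-∸-assoc 1 i<n) (<ᵇ⇒<′ _ _ e)))
  ... | inj₁ lt = inj₁ (<⇒<ᵇ′ lt)
  ... | inj₂ eq = inj₂ (trans (≡-sym (inverseʳ π)) (cong (π ⟨$⟩ʳ_)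
    (Fin.toℕ-injective (trans eq (≡-sym (Fin.toℕ-fromℕ< _))))))

-- Here the ball is taken over `suc i` but counted in the parts of `i`, where one more vertex
-- belongs to the set. `suc k` is the range of `indexOf`, and 3 counts the new vertex, its
-- neighbours and its non-neighbours.
DMW⇒PMW : ∀ {k n} {G : Graph n} → DMW∞≤ k G → PMW∞≤ (suc k * 3) G
DMW⇒PMW {k} {n} {G} (π , small) = record
  { m = n ; P = λ i → E.encode i ; first = first ; last = last
  ; mono = λ i _ x y e → E.encode⁺ (suc i) (atomicTypes-mono G (prefix-anti π i) x y (E.encode⁻ i e))
  ; width = width }
  where
  type : ∀ i → Fin n → Fin n ⊎ Vec.Vec Bool n
  type i = atomicTypes G (orderPrefix π i)
  module E (i : ℕ) = Encode _≟ᵗ_ (type i)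

  first : Singletons (E.encode 0)
  -- For `i = 0` the prefix contains all vertices, each of which is its own type.
  first x y e = sameType-S G (orderPrefix π 0) {x} {y} (<⇒<ᵇ′ (Fin.toℕ<n (π ⟨$⟩ˡ x))) (E.encode⁻ 0 e)

  last : Whole (E.encode n)
  last x y = E.encode⁺ n (sameType⁺ G (orderPrefix π n) (none x) (none y)
    λ s e → ⊥-elim (false≢true (none s) e))
    where
    none : ∀ s → orderPrefix π n s ≡ false
    none s rewrite ℕ.n∸n≡0 n = refl

  width : ∀ i → i < n → ∀ v → AtMostParts (suc k * 3) (E.encode i) (BallP∞ G (E.encode (suc i)) v)
  width i i<n v = AtMostParts-⊆ (λ {y} ball → covers y (E.BallP-encode (suc i) G ball))
    (codeParts (λ y → Fin.any? λ j → type (suc i) y ≟ᵗ f j) v code same)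
    where
    f = proj₁ (small (suc i) (s≤s z≤n) i<n v)
    covers = proj₂ (small (suc i) (s≤s z≤n) i<n v)
    w = newest π i i<n
    side : Fin n → Fin 3
    side y = if ⌊ y ≟ w ⌋ then zero else if adj G y w then suc zero else suc (suc zero)
    side≡ : ∀ {y y′} → side y ≡ side y′ → y ≡ y′ ⊎ (y ≢ w × y′ ≢ w × adj G y w ≡ adj G y′ w)
    side≡ {y} {y′} e with y ≟ w | y′ ≟ w | adj G y w | adj G y′ w
    ... | yes p | yes q | _ | _ = inj₁ (trans p (≡-sym q))
    ... | yes _ | no _ | _ | true = case e of λ ()
    ... | yes _ | no _ | _ | false = case e of λ ()
    ... | no _ | yes _ | true | _ = case e of λ ()
    ... | no _ | yes _ | false | _ = case e of λ ()
    ... | no p | no q | true | true = inj₂ (p , q , refl)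
    ... | no p | no q | false | false = inj₂ (p , q , refl)
    ... | no _ | no _ | true | false = case e of λ ()
    ... | no _ | no _ | false | true = case e of λ ()
    code : Fin n → Fin (suc k * 3)
    code y = combine (indexOf _≟ᵗ_ f (type (suc i) y)) (side y)
    same : ∀ {x x′} → (∃ λ j → type (suc i) x ≡ f j) → (∃ λ j → type (suc i) x′ ≡ f j) →
      code x ≡ code x′ → E.encode i x ≡ E.encode i x′
    same {x} {x′} Xx _ e = E.encode⁺ i (refine (side≡ (proj₂ e₂)))
      where
      e₂ = Fin.combine-injective _ _ _ _ e
      refine : x ≡ x′ ⊎ (x ≢ w × x′ ≢ w × adj G x w ≡ adj G x′ w) → type i x ≡ type i x′
      refine (inj₁ refl) = refl
      refine (inj₂ (x≢w , x′≢w , ew))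
        with sameType⁻ G (orderPrefix π (suc i)) {x} {x′} (indexOf-injective _≟ᵗ_ f Xx (proj₁ e₂))
      ... | inj₁ refl = refl
      ... | inj₂ (Sx , Sx′ , h) = sameType⁺ G (orderPrefix π i) (out Sx x≢w) (out Sx′ x′≢w) λ s Ss →
            case prefix-step π i i<n Ss of λ where
              (inj₁ S′s) → h s S′s
              (inj₂ refl) → ew
        where
        out : ∀ {z} → orderPrefix π (suc i) z ≡ false → z ≢ w → orderPrefix π i z ≡ false
        out {z} Sz z≢w = ≢true⇒false λ Sz′ → case prefix-step π i i<n {z} Sz′ of λ where
          (inj₁ t) → false≢true Sz t
          (inj₂ t) → z≢w t

-- Separating vertices by flips

-- `us` holds the vertices not yet reached; those with an edge from outside `us` are removed one at
-- a time. At the end no edge enters `us`, which decides reachability from `v`.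
component : ∀ {n} (E : Fin n → Fin n → Bool) v → Σ (List (Fin n)) λ us →
  (∀ x → x ∈ us ⊎ Ball∞ E v x) × v ∉ us × (∀ {a b} → a ∉ us → E a b ≡ true → b ∉ us)
component {n} E v = grow _ (filter (¬? ∘ (_≟ v)) (allFin n)) ℕ.≤-refl start
    λ v∈ → proj₂ (∈-filter⁻ (¬? ∘ (_≟ v)) {xs = allFin n} v∈) refl
  where
  start : ∀ x → x ∈ filter (¬? ∘ (_≟ v)) (allFin n) ⊎ Ball∞ E v x
  start x with x ≟ v
  ... | yes refl = inj₂ ε
  ... | no x≢v = inj₁ (∈-filter⁺ (¬? ∘ (_≟ v)) (∈-allFin x) x≢v)
  grow : ∀ fuel us → length us ≤ fuel → (∀ x → x ∈ us ⊎ Ball∞ E v x) → v ∉ us → Σ (List (Fin n)) λ us →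
    (∀ x → x ∈ us ⊎ Ball∞ E v x) × v ∉ us × (∀ {a b} → a ∉ us → E a b ≡ true → b ∉ us)
  grow zero [] _ inv v∉ = [] , inv , v∉ , λ _ _ ()
  grow (suc fuel) us le inv v∉
    with Fin.any? (λ a → Fin.any? λ b → ¬? (a ∈? us) ×-dec (b ∈? us) ×-dec (E a b Bool.≟ true))
  ... | no none = us , inv , v∉ , λ a∉ e b∈ → none (_ , _ , a∉ , b∈ , e)
  ... | yes (a , b , a∉ , b∈ , e) = grow fuel (filter (¬? ∘ (_≟ b)) us)
        (s≤s⁻¹ (ℕ.≤-trans (filter-notAll (¬? ∘ (_≟ b)) us (lose b∈ λ ne → ne refl)) le))
        inv′ (λ v∈ → v∉ (proj₁ (∈-filter⁻ (¬? ∘ (_≟ b)) v∈)))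
    where
    inv′ : ∀ x → x ∈ filter (¬? ∘ (_≟ b)) us ⊎ Ball∞ E v x
    inv′ x with inv x
    ... | inj₂ r = inj₂ r
    ... | inj₁ x∈ with x ≟ b
    ...   | no x≢b = inj₁ (∈-filter⁺ (¬? ∘ (_≟ b)) x∈ x≢b)
    ...   | yes refl with inv a
    ...     | inj₁ a∈ = contradiction a∈ a∉
    ...     | inj₂ r = inj₂ (r ◅◅ e ◅ ε)

-- A certificate against `BallP∞`: under the flip `F` no edge enters `far`, so no path from `v`
-- reaches `y`. All pairs across `far` thereby become known non-edges of the flip.
record Separation {n} {L : Set} (G : Graph n) (p : Fin n → L) (v y : Fin n) : Set where
  field
    F      : L → L → Bool
    far    : List (Fin n)
    near-v : v ∉ far
    far-y  : y ∈ far
    closed : ∀ {a b} → a ∉ far → flipAdj G p F a b ≡ true → b ∉ far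

-- Only the values of a flip on the finitely many labels in use matter, so all flips can be searched.
separate? : ∀ {n} {L : Set} → DecidableEquality L → (G : Graph n) (p : Fin n → L) → ∀ v y →
  BallP∞ G p v y ⊎ Separation G p v y
separate? {n} {L} _≟L_ G p v y =
  case anySubset? (λ s → y ∈? proj₁ (component (flipAdj G p (flipOf s)) v)) of λ where
    (yes (s , y∈)) → let (us , _ , v∉ , cl) = component (flipAdj G p (flipOf s)) v in
      inj₂ record { F = flipOf s ; far = us ; near-v = v∉ ; far-y = y∈ ; closed = cl }
    (no none) → inj₁ (reach none)
  where
  rep : L → Fin n
  rep a with Fin.any? (λ z → p z ≟L a)
  ... | yes (z , _) = z
  ... | no _ = v
  p-rep : ∀ x → p (rep (p x)) ≡ p x
  p-rep x with Fin.any? (λ z → p z ≟L p x)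
  ... | yes (_ , e) = e
  ... | no ¬z = contradiction (x , refl) ¬z
  flipOf : Subset (n * n) → L → L → Bool
  flipOf s a b = Vec.lookup s (combine (rep a) (rep b))
  reach : ¬ (∃ λ s → y ∈ proj₁ (component (flipAdj G p (flipOf s)) v)) → BallP∞ G p v y
  reach none F = case proj₁ (proj₂ (component (flipAdj G p (flipOf values)) v)) y of λ where
      (inj₁ y∈) → contradiction (values , y∈) none
      (inj₂ path) → Ball-map (λ a b → trans (flipAdj-cong G p p F (flipOf values) agree a b)) path
    where
    value : Fin (n * n) → Bool
    value c = F (p (proj₁ (remQuot n c))) (p (proj₂ (remQuot {n} n c)))
    values : Subset (n * n)
    values = Vec.tabulate value
    agree : ∀ a b → F (p a) (p b) ≡ flipOf values (p a) (p b)
    agree a b = ≡-sym (begin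
      flipOf values (p a) (p b)                ≡⟨ Vec.lookup∘tabulate value (combine (rep (p a)) (rep (p b))) ⟩
      value (combine (rep (p a)) (rep (p b)))  ≡⟨ cong (λ (i , j) → F (p i) (p j))
                                                    (Fin.remQuot-combine (rep (p a)) (rep (p b))) ⟩
      F (p (rep (p a))) (p (rep (p b)))        ≡⟨ cong₂ F (p-rep a) (p-rep b) ⟩
      F (p a) (p b)                            ∎)
      where open ≡-Reasoning

-- Decomposition trees with labels

module _ {n : ℕ} where

  Disjoint : List (Fin n) → List (Fin n) → Set
  Disjoint xs ys = ∀ {x} → x ∈ xs → x ∈ ys → ⊥

  Refines : ∀ {k} → List (Fin n) → (Fin n → Fin k) → (Fin n → Fin k) → Set
  Refines xs f g = ∀ {x x′} → x ∈ xs → x′ ∈ xs → f x ≡ f x′ → g x ≡ g x′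

  Cross : ∀ {k} → Graph n → List (Fin n) → (Fin n → Fin k) → List (Fin n) → (Fin n → Fin k) → Set
  Cross G xs f ys g = ∀ {x x′ y y′} → x ∈ xs → x′ ∈ xs → y ∈ ys → y′ ∈ ys →
    f x ≡ f x′ → g y ≡ g y′ → adj G x y ≡ adj G x′ y′

  -- Essentially an NLC-decomposition with `k` labels: `Cross` and `Refines` say that the join
  -- relation and the relabelling maps exist, without naming them. Labels are defined on all
  -- vertices, but only their values on the list matter.
  data Decomp (G : Graph n) (k : ℕ) : List (Fin n) → (Fin n → Fin k) → Set where
    nil  : ∀ {lab} → Decomp G k [] lab
    leaf : ∀ {lab} v → Decomp G k (v ∷ []) lab
    node : ∀ {xs ys f g lab} → Decomp G k xs f → Decomp G k ys g → Disjoint xs ys →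
           Cross G xs f ys g → Refines xs f lab → Refines ys g lab → Decomp G k (xs ++ ys) lab

  relabelled : ∀ {G k xs f g} → Refines xs f g → Decomp G k xs f → Decomp G k xs g
  relabelled r nil = nil
  relabelled r (leaf v) = leaf v
  relabelled r (node {xs} d e dis cr r₁ r₂) = node d e dis cr
    (λ x∈ x′∈ → r (∈-++⁺ˡ x∈) (∈-++⁺ˡ x′∈) ∘ r₁ x∈ x′∈)
    (λ y∈ y′∈ → r (∈-++⁺ʳ xs y∈) (∈-++⁺ʳ xs y′∈) ∘ r₂ y∈ y′∈)

  Decomposable : ℕ → Graph n → Set
  Decomposable k G = ∃₂ λ xs lab → Decomp G k xs lab × (∀ x → x ∈ xs)

-- From chains of partitions to decompositions

Whole⇒constant : ∀ {n} (p : Fin n → ℕ) → Whole p → ∃ λ c → ∀ x → p x ≡ c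
Whole⇒constant {zero} p w = 0 , λ ()
Whole⇒constant {suc n} p w = p zero , λ x → w x zero

PMW⇒Decomposable : ∀ {k n} {G : Graph n} → PMW∞≤ k G → Decomposable (2 + k) G
PMW⇒Decomposable {k₀} {n} {G} M =
  let (c , p≡c) = Whole⇒constant (P m) last
      (xs , d , to , _) = decompose m ℕ.≤-refl (λ _ → c) (allFin n) (Unique.allFin⁺ n)
        (λ {x} _ → zero , p≡c x)
  in xs , _ , d , λ x → to (∈-allFin x)
  where
  open PMW∞≤ M
  -- One slot more than the width, so that the list of parts at the top has room for the single part
  -- even if `k₀` is 0; `indexOf` then takes one further label.
  k = suc k₀
  K = suc k
  lab : (Fin k → ℕ) → ℕ → Fin n → Fin K
  lab f i x = indexOf ℕ._≟_ f (P i x)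
  Covered : ℕ → (Fin k → ℕ) → List (Fin n) → Set
  Covered i f xs = ∀ {x} → x ∈ xs → ∃ λ j → P i x ≡ f j
  Built : ℕ → (Fin k → ℕ) → List (Fin n) → Set
  Built i f xs = ∃ λ ys → Decomp G K ys (lab f i) × (∀ {x} → x ∈ xs → x ∈ ys) × (∀ {x} → x ∈ ys → x ∈ xs)

  -- `P 0` has singleton parts, so labels identify the vertices of `xs` and adjacency can be read
  -- off them; any tree will do, here a caterpillar.
  singles : ∀ f xs → Unique xs → Covered 0 f xs → Decomp G K xs (lab f 0)
  singles f [] _ _ = nil
  singles f (x ∷ xs) (x∉ ∷ u) cov = node (leaf x) (singles f xs u (cov ∘ there))
    (λ where (here refl) x∈ → All.lookup x∉ x∈ refl)
    (λ where (here refl) (here refl) y∈ y′∈ _ e → cong (adj G x)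
               (first _ _ (indexOf-injective ℕ._≟_ f (cov (there y∈)) e)))
    (λ _ _ → id) (λ _ _ → id)

  search : ∀ i v zs → (∀ {y} → y ∈ zs → BallP∞ G (P i) v y) ⊎ (∃ λ y → y ∈ zs × Separation G (P i) v y)
  search i v [] = inj₁ λ ()
  search i v (z ∷ zs) with separate? ℕ._≟_ G (P i) v z | search i v zs
  ... | inj₂ s | _ = inj₂ (z , here refl , s)
  ... | inj₁ _ | inj₂ (y , y∈ , s) = inj₂ (y , there y∈ , s)
  ... | inj₁ b | inj₁ bs = inj₁ λ where
    (here refl) → b
    (there y∈) → bs y∈

  -- `lower` deals with sets contained in one ball. Otherwise some flip separates `v` from `y`; the
  -- near half lacks `y` and the far half lacks `v`, so both are shorter. Labels stay the parts of
  -- `P (suc i)` throughout, so a split relabels nothing.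
  refine : ∀ i f → (∀ v xs → Unique xs → (∀ {y} → y ∈ xs → BallP∞ G (P (suc i)) v y) → Built (suc i) f xs) →
    ∀ fuel xs → length xs ≤ fuel → Unique xs → Covered (suc i) f xs → Built (suc i) f xs
  refine i f lower _ [] _ _ _ = [] , nil , id , id
  refine i f lower (suc fuel) xs@(v ∷ _) le u cov with search (suc i) v xs
  ... | inj₁ together = lower v xs u together
  ... | inj₂ (y , y∈ , s) = zs , node d₁ d₂
        (λ x∈₁ x∈₂ → near (from₁ x∈₁) (far′ (from₂ x∈₂)))
        cross (λ _ _ → id) (λ _ _ → id) , to , from
    where
    open Separation s
    near? = λ x → ¬? (x ∈? far)
    far? = _∈? far
    near : ∀ {x} → x ∈ filter near? xs → x ∉ far
    near x∈ = proj₂ (∈-filter⁻ near? {xs = xs} x∈)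
    far′ : ∀ {x} → x ∈ filter far? xs → x ∈ far
    far′ x∈ = proj₂ (∈-filter⁻ far? {xs = xs} x∈)
    part₁ = refine i f lower fuel (filter near? xs)
      (s≤s⁻¹ (ℕ.≤-trans (filter-notAll near? xs (lose y∈ λ y∉ → y∉ far-y)) le))
      (Unique.filter⁺ near? u) (cov ∘ proj₁ ∘ ∈-filter⁻ near?)
    part₂ = refine i f lower fuel (filter far? xs)
      (s≤s⁻¹ (ℕ.≤-trans (filter-notAll far? xs (here near-v)) le))
      (Unique.filter⁺ far? u) (cov ∘ proj₁ ∘ ∈-filter⁻ far?)
    ys₁ = proj₁ part₁
    ys₂ = proj₁ part₂
    zs = ys₁ ++ ys₂
    d₁ = proj₁ (proj₂ part₁)
    d₂ = proj₁ (proj₂ part₂)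
    from₁ : ∀ {x} → x ∈ ys₁ → x ∈ filter near? xs
    from₁ = proj₂ (proj₂ (proj₂ part₁))
    from₂ : ∀ {x} → x ∈ ys₂ → x ∈ filter far? xs
    from₂ = proj₂ (proj₂ (proj₂ part₂))
    to : ∀ {x} → x ∈ xs → x ∈ zs
    to {x} x∈ with x ∈? far
    ... | yes fr = ∈-++⁺ʳ ys₁ (proj₁ (proj₂ (proj₂ part₂)) (∈-filter⁺ far? x∈ fr))
    ... | no nr = ∈-++⁺ˡ (proj₁ (proj₂ (proj₂ part₁)) (∈-filter⁺ near? x∈ nr))
    from : ∀ {x} → x ∈ zs → x ∈ xs
    from x∈ with ∈-++⁻ ys₁ x∈
    ... | inj₁ x∈₁ = proj₁ (∈-filter⁻ near? (from₁ x∈₁))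
    ... | inj₂ x∈₂ = proj₁ (∈-filter⁻ far? (from₂ x∈₂))
    flipped : ∀ {x y} → x ∈ ys₁ → y ∈ ys₂ →
      adj G x y ≡ F (P (suc i) x) (P (suc i) y) ∨ F (P (suc i) y) (P (suc i) x)
    flipped x∈ y∈ = nonedge-flip G (P (suc i)) F
      (λ where refl → near (from₁ x∈) (far′ (from₂ y∈)))
      (≢true⇒false λ e → closed (near (from₁ x∈)) e (far′ (from₂ y∈)))
    cross : Cross G ys₁ (lab f (suc i)) ys₂ (lab f (suc i))
    cross x∈ x′∈ y∈ y′∈ e e′ = trans (flipped x∈ y∈) (trans
      (cong₂ (λ a b → F a b ∨ F b a)
        (indexOf-injective ℕ._≟_ f (cov (proj₁ (∈-filter⁻ near? (from₁ x∈)))) e)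
        (indexOf-injective ℕ._≟_ f (cov (proj₁ (∈-filter⁻ far? (from₂ y∈)))) e′))
      (≡-sym (flipped x′∈ y′∈)))

  decompose : ∀ i → i ≤ m → ∀ f xs → Unique xs → Covered i f xs → Built i f xs
  decompose zero _ f xs u cov = xs , singles f xs u cov , id , id
  decompose (suc i) i<m f xs u cov = refine i f lower _ xs ℕ.≤-refl u cov
    where
    lower : ∀ v xs → Unique xs → (∀ {y} → y ∈ xs → BallP∞ G (P (suc i)) v y) → Built (suc i) f xs
    lower v xs u together =
      let (f₀ , cov₀) = width i i<m v
          f′ : Fin k → ℕ
          -- `width` lists only `k₀` parts; the entry at `zero` is padding.
          f′ = λ { zero → 0 ; (suc j) → f₀ j }
          cov′ : Covered i f′ xs
          cov′ = λ {x} x∈ → let (j , e) = cov₀ x (together x∈) in suc j , e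
          (ys , d , to , from) = decompose i (ℕ.<⇒≤ i<m) f′ xs u cov′
      -- Coarsening by `mono` turns labels by parts of `P i` into labels by parts of `P (suc i)`.
      in ys , relabelled (λ x∈ _ e → cong (indexOf ℕ._≟_ f)
                (mono i i<m _ _ (indexOf-injective ℕ._≟_ f′ (cov′ (from x∈)) e))) d , to , from

-- From clique-width expressions to decompositions

splitView : ∀ m {n} (x : Fin (m + n)) → (∃ λ a → x ≡ a ↑ˡ n) ⊎ (∃ λ b → x ≡ m ↑ʳ b)
splitView m x with splitAt m x in eq
... | inj₁ a = inj₁ (a , ≡-sym (Fin.splitAt⁻¹-↑ˡ eq))
... | inj₂ b = inj₂ (b , ≡-sym (Fin.splitAt⁻¹-↑ʳ eq))

module _ {k m n : ℕ} (e₁ : Expr k m) (e₂ : Expr k n) where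

  adj-union-ˡˡ : ∀ a b → evalAdj (union e₁ e₂) (a ↑ˡ n) (b ↑ˡ n) ≡ evalAdj e₁ a b
  adj-union-ˡˡ a b rewrite Fin.splitAt-↑ˡ m a n | Fin.splitAt-↑ˡ m b n = refl

  adj-union-ʳʳ : ∀ a b → evalAdj (union e₁ e₂) (m ↑ʳ a) (m ↑ʳ b) ≡ evalAdj e₂ a b
  adj-union-ʳʳ a b rewrite Fin.splitAt-↑ʳ m n a | Fin.splitAt-↑ʳ m n b = refl

  adj-union-ˡʳ : ∀ a b → evalAdj (union e₁ e₂) (a ↑ˡ n) (m ↑ʳ b) ≡ false
  adj-union-ˡʳ a b rewrite Fin.splitAt-↑ˡ m a n | Fin.splitAt-↑ʳ m n b = refl

  adj-union-ʳˡ : ∀ a b → evalAdj (union e₁ e₂) (m ↑ʳ a) (b ↑ˡ n) ≡ false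
  adj-union-ʳˡ a b rewrite Fin.splitAt-↑ʳ m n a | Fin.splitAt-↑ˡ m b n = refl

  lab-union-ˡ : ∀ a → evalLab (union e₁ e₂) (a ↑ˡ n) ≡ evalLab e₁ a
  lab-union-ˡ a rewrite Fin.splitAt-↑ˡ m a n = refl

  lab-union-ʳ : ∀ b → evalLab (union e₁ e₂) (m ↑ʳ b) ≡ evalLab e₂ b
  lab-union-ʳ b rewrite Fin.splitAt-↑ʳ m n b = refl

module FromExpr {k n : ℕ} (G : Graph n) where

  -- Labels of a decomposition are total on the vertices of `G`; `zero` is given to those outside
  -- the image of `φ`.
  labOf : ∀ {m} → Expr k m → (Fin m → Fin n) → Fin n → Fin (suc k)
  labOf e φ v with Fin.any? (λ x → φ x ≟ v)
  ... | yes (x , _) = suc (evalLab e x)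
  ... | no _ = zero

  labOf-φ : ∀ {m} (e : Expr k m) {φ} → Injective _≡_ _≡_ φ → ∀ x → labOf e φ (φ x) ≡ suc (evalLab e x)
  labOf-φ e {φ} inj x with Fin.any? (λ z → φ z ≟ φ x)
  ... | yes (z , eq) = cong (suc ∘ evalLab e) (inj eq)
  ... | no ¬z = contradiction (x , refl) ¬z

  Image : ∀ {m} → Expr k m → (Fin m → Fin n) → Set
  Image e φ = ∃ λ xs → Decomp G (suc k) xs (labOf e φ) × (∀ {v} → v ∈ xs → ∃ λ x → v ≡ φ x) × (∀ x → φ x ∈ xs)

  image-relabelled : ∀ {m} (e e′ : Expr k m) {φ} → Injective _≡_ _≡_ φ →
    (∀ x x′ → evalLab e x ≡ evalLab e x′ → evalLab e′ x ≡ evalLab e′ x′) → Image e φ → Image e′ φ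
  image-relabelled e e′ {φ} inj h (xs , d , from , to) = xs , relabelled r d , from , to
    where
    r : Refines xs (labOf e φ) (labOf e′ φ)
    r v∈ v′∈ eq with from v∈ | from v′∈
    ... | x , refl | x′ , refl = trans (labOf-φ e′ inj x) (trans
      (cong suc (h x x′ (Fin.suc-injective (trans (≡-sym (labOf-φ e inj x)) (trans eq (labOf-φ e inj x′))))))
      (≡-sym (labOf-φ e′ inj x′)))

  -- c records the joins performed above e, expressed in the labels of e.
  fromExpr : ∀ {m} (e : Expr k m) (φ : Fin m → Fin n) → Injective _≡_ _≡_ φ → (c : Fin k → Fin k → Bool) →
    (∀ x y → adj G (φ x) (φ y) ≡ evalAdj e x y ∨ c (evalLab e x) (evalLab e y)) → Image e φ
  fromExpr empty φ inj c h = [] , nil , (λ ()) , λ ()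
  fromExpr (vertex i) φ inj c h = φ zero ∷ [] , leaf (φ zero) , (λ { (here refl) → zero , refl }) , λ { zero → here refl }
  fromExpr (join i j i≢j e) φ inj c h = image-relabelled e (join i j i≢j e) inj (λ _ _ → id)
    (fromExpr e φ inj (λ a b → ((a == i ∧ b == j) ∨ (a == j ∧ b == i)) ∨ c a b)
      λ x y → trans (h x y) (Bool.∨-assoc (evalAdj e x y) _ _))
  fromExpr (relabel i j e) φ inj c h = image-relabelled e (relabel i j e) inj
    (λ x x′ → cong (λ a → if a == i then j else a))
    -- A later join sees the labels after this relabelling, so `c` is precomposed with it.
    (fromExpr e φ inj (λ a b → c (if a == i then j else a) (if b == i then j else b)) h)
  fromExpr {m₁₂} (union {m} {m′} e₁ e₂) φ inj c h
    with fromExpr e₁ (φ ∘ (_↑ˡ m′)) (Fin.↑ˡ-injective m′ _ _ ∘ inj) c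
           (λ x y → trans (h _ _) (cong₂ _∨_ (adj-union-ˡˡ e₁ e₂ x y)
                                             (cong₂ c (lab-union-ˡ e₁ e₂ x) (lab-union-ˡ e₁ e₂ y))))
       | fromExpr e₂ (φ ∘ (m ↑ʳ_)) (Fin.↑ʳ-injective m _ _ ∘ inj) c
           (λ x y → trans (h _ _) (cong₂ _∨_ (adj-union-ʳʳ e₁ e₂ x y)
                                             (cong₂ c (lab-union-ʳ e₁ e₂ x) (lab-union-ʳ e₁ e₂ y))))
  ... | xs , d₁ , from₁ , to₁ | ys , d₂ , from₂ , to₂ =
    xs ++ ys , node d₁ d₂ disjoint cross refines₁ refines₂ , from , to
    where
    inj₁′ : Injective _≡_ _≡_ (φ ∘ (_↑ˡ m′))
    inj₁′ = Fin.↑ˡ-injective m′ _ _ ∘ inj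
    inj₂′ : Injective _≡_ _≡_ (φ ∘ (m ↑ʳ_))
    inj₂′ = Fin.↑ʳ-injective m _ _ ∘ inj
    lab₁ : ∀ {a a′} → labOf e₁ (φ ∘ (_↑ˡ m′)) (φ (a ↑ˡ m′)) ≡ labOf e₁ (φ ∘ (_↑ˡ m′)) (φ (a′ ↑ˡ m′)) →
      evalLab e₁ a ≡ evalLab e₁ a′
    lab₁ {a} {a′} eq = Fin.suc-injective (trans (≡-sym (labOf-φ e₁ inj₁′ a)) (trans eq (labOf-φ e₁ inj₁′ a′)))
    lab₂ : ∀ {b b′} → labOf e₂ (φ ∘ (m ↑ʳ_)) (φ (m ↑ʳ b)) ≡ labOf e₂ (φ ∘ (m ↑ʳ_)) (φ (m ↑ʳ b′)) →
      evalLab e₂ b ≡ evalLab e₂ b′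
    lab₂ {b} {b′} eq = Fin.suc-injective (trans (≡-sym (labOf-φ e₂ inj₂′ b)) (trans eq (labOf-φ e₂ inj₂′ b′)))
    disjoint : Disjoint xs ys
    disjoint x∈ y∈ with from₁ x∈ | from₂ y∈
    ... | a , refl | b , eq = case trans (≡-sym (Fin.splitAt-↑ˡ m a m′))
      (trans (cong (splitAt m) (inj eq)) (Fin.splitAt-↑ʳ m m′ b)) of λ ()
    -- `union` itself creates no edge across, so these edges all come from later joins.
    across : ∀ a b → adj G (φ (a ↑ˡ m′)) (φ (m ↑ʳ b)) ≡ c (evalLab e₁ a) (evalLab e₂ b)
    across a b = trans (h _ _) (cong₂ _∨_ (adj-union-ˡʳ e₁ e₂ a b)
      (cong₂ c (lab-union-ˡ e₁ e₂ a) (lab-union-ʳ e₁ e₂ b)))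
    cross : Cross G xs (labOf e₁ (φ ∘ (_↑ˡ m′))) ys (labOf e₂ (φ ∘ (m ↑ʳ_)))
    cross x∈ x′∈ y∈ y′∈ eq eq′ with from₁ x∈ | from₁ x′∈ | from₂ y∈ | from₂ y′∈
    ... | a , refl | a′ , refl | b , refl | b′ , refl =
      trans (across a b) (trans (cong₂ c (lab₁ eq) (lab₂ eq′)) (≡-sym (across a′ b′)))
    refines₁ : Refines xs (labOf e₁ (φ ∘ (_↑ˡ m′))) (labOf (union e₁ e₂) φ)
    refines₁ x∈ x′∈ eq with from₁ x∈ | from₁ x′∈
    ... | a , refl | a′ , refl = trans (labOf-φ (union e₁ e₂) inj _) (trans
      (cong suc (trans (lab-union-ˡ e₁ e₂ a) (trans (lab₁ eq) (≡-sym (lab-union-ˡ e₁ e₂ a′)))))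
      (≡-sym (labOf-φ (union e₁ e₂) inj _)))
    refines₂ : Refines ys (labOf e₂ (φ ∘ (m ↑ʳ_))) (labOf (union e₁ e₂) φ)
    refines₂ x∈ x′∈ eq with from₂ x∈ | from₂ x′∈
    ... | b , refl | b′ , refl = trans (labOf-φ (union e₁ e₂) inj _) (trans
      (cong suc (trans (lab-union-ʳ e₁ e₂ b) (trans (lab₂ eq) (≡-sym (lab-union-ʳ e₁ e₂ b′)))))
      (≡-sym (labOf-φ (union e₁ e₂) inj _)))
    from : ∀ {v} → v ∈ xs ++ ys → ∃ λ x → v ≡ φ x
    from v∈ with ∈-++⁻ xs v∈
    ... | inj₁ v∈₁ = let (a , eq) = from₁ v∈₁ in a ↑ˡ m′ , eq
    ... | inj₂ v∈₂ = let (b , eq) = from₂ v∈₂ in m ↑ʳ b , eq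
    to : ∀ x → φ x ∈ xs ++ ys
    to x with splitView m x
    ... | inj₁ (a , refl) = ∈-++⁺ˡ (to₁ a)
    ... | inj₂ (b , refl) = ∈-++⁺ʳ xs (to₂ b)

CW⇒Decomposable : ∀ {k n} {G : Graph n} → CW≤ k G → Decomposable (suc k) G
CW⇒Decomposable {G = G} (e , π , h) =
  let (xs , d , _ , to) = FromExpr.fromExpr G e (π ⟨$⟩ʳ_)
        (λ eq → trans (≡-sym (inverseˡ π)) (trans (cong (π ⟨$⟩ˡ_) eq) (inverseˡ π)))
        -- No join lies above the whole expression.
        (λ _ _ → false) (λ x y → trans (h x y) (≡-sym (Bool.∨-identityʳ _)))
  in xs , _ , d , λ v → subst (_∈ xs) (inverseʳ π) (to (π ⟨$⟩ˡ v))

-- From decompositions to clique-width expressions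

==-true : ∀ {k} {a b : Fin k} → (a == b) ≡ true → a ≡ b
==-true {a = a} {b} = ⌊⌋-true (a ≟ b)

==-refl : ∀ {k} (a : Fin k) → (a == a) ≡ true
==-refl a = true⇒⌊⌋ (a ≟ a) refl

∧-true : ∀ a {b} → a ∧ b ≡ true → a ≡ true × b ≡ true
∧-true true h = refl , h

module Recolour {K : ℕ} (g : Fin K → Fin K) (idem : ∀ i → g (g i) ≡ g i) where

  relabels : ∀ {m} → List (Fin K) → Expr K m → Expr K m
  relabels [] e = e
  relabels (i ∷ is) e = relabels is (relabel i (g i) e)

  relabels-adj : ∀ {m} is (e : Expr K m) x y → evalAdj (relabels is e) x y ≡ evalAdj e x y
  relabels-adj [] e x y = refl
  relabels-adj (i ∷ is) e x y = relabels-adj is (relabel i (g i) e) x y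

  -- By idempotence, a label that has already been replaced is not changed again.
  relabels-lab : ∀ {m} is (e : Expr K m) x a →
    (evalLab e x ≡ a × a ∈ is) ⊎ evalLab e x ≡ g a → evalLab (relabels is e) x ≡ g a
  relabels-lab [] e x a (inj₂ eq) = eq
  relabels-lab (i ∷ is) e x a h = relabels-lab is (relabel i (g i) e) x a (step h)
    where
    step : (evalLab e x ≡ a × a ∈ i ∷ is) ⊎ evalLab e x ≡ g a →
      ((if evalLab e x == i then g i else evalLab e x) ≡ a × a ∈ is) ⊎
      (if evalLab e x == i then g i else evalLab e x) ≡ g a
    step h with evalLab e x ≟ i
    step (inj₁ (eq , _)) | yes eq′ = inj₂ (cong g (trans (≡-sym eq′) eq))
    step (inj₂ eq) | yes eq′ = inj₂ (trans (cong g (trans (≡-sym eq′) eq)) (idem a))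
    step (inj₁ (eq , here refl)) | no ne = contradiction eq ne
    step (inj₁ (eq , there a∈)) | no _ = inj₁ (eq , a∈)
    step (inj₂ eq) | no _ = inj₂ eq

  recolour : ∀ {m} → Expr K m → Expr K m
  recolour = relabels (allFin K)

  recolour-adj : ∀ {m} (e : Expr K m) x y → evalAdj (recolour e) x y ≡ evalAdj e x y
  recolour-adj = relabels-adj (allFin K)

  recolour-lab : ∀ {m} (e : Expr K m) x → evalLab (recolour e) x ≡ g (evalLab e x)
  recolour-lab e x = relabels-lab (allFin K) e x (evalLab e x) (inj₁ (refl , ∈-allFin _))

module Joins {K : ℕ} where

  Pair : Set
  Pair = ∃₂ λ (i j : Fin K) → i ≢ j

  joins : ∀ {m} → List Pair → Expr K m → Expr K m
  joins [] e = e
  joins ((i , j , i≢j) ∷ ps) e = join i j i≢j (joins ps e)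

  joins-lab : ∀ {m} ps (e : Expr K m) x → evalLab (joins ps e) x ≡ evalLab e x
  joins-lab [] e x = refl
  joins-lab (_ ∷ ps) e x = joins-lab ps e x

  Matches : Fin K → Fin K → Pair → Set
  Matches a b (i , j , _) = (a ≡ i × b ≡ j) ⊎ (a ≡ j × b ≡ i)

  joins-old : ∀ {m} ps (e : Expr K m) {x y} → evalAdj e x y ≡ true → evalAdj (joins ps e) x y ≡ true
  joins-old [] e h = h
  joins-old (_ ∷ ps) e h = ∨-trueˡ _ (joins-old ps e h)

  joins-new : ∀ {m} ps (e : Expr K m) {x y} → Any (Matches (evalLab e x) (evalLab e y)) ps →
    evalAdj (joins ps e) x y ≡ true
  joins-new (_ ∷ ps) e (there h) = ∨-trueˡ _ (joins-new ps e h)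
  joins-new ((i , j , _) ∷ ps) e {x} {y} (here (inj₁ (refl , refl)))
    rewrite joins-lab ps e x | joins-lab ps e y | ==-refl (evalLab e x) | ==-refl (evalLab e y) =
    Bool.∨-zeroʳ _
  joins-new ((i , j , _) ∷ ps) e {x} {y} (here (inj₂ (refl , refl)))
    rewrite joins-lab ps e x | joins-lab ps e y | ==-refl (evalLab e x) | ==-refl (evalLab e y) =
    ∨-trueʳ (evalAdj (joins ps e) x y) (Bool.∨-zeroʳ _)

  joins⁻ : ∀ {m} ps (e : Expr K m) {x y} → evalAdj (joins ps e) x y ≡ true →
    evalAdj e x y ≡ true ⊎ Any (Matches (evalLab e x) (evalLab e y)) ps
  joins⁻ [] e h = inj₁ h
  joins⁻ ((i , j , _) ∷ ps) e {x} {y} h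
    with ∨-true (evalAdj (joins ps e) x y) h
  ... | inj₁ old = Sum.map₂ there (joins⁻ ps e old)
  ... | inj₂ new rewrite joins-lab ps e x | joins-lab ps e y
    with ∨-true (evalLab e x == i ∧ evalLab e y == j) new
  ...   | inj₁ t = let (p , q) = ∧-true (evalLab e x == i) t in inj₂ (here (inj₁ (==-true p , ==-true q)))
  ...   | inj₂ t = let (p , q) = ∧-true (evalLab e x == j) t in inj₂ (here (inj₂ (==-true p , ==-true q)))

-- An expression with three blocks of k labels: block 0 holds the result, a second operand is moved
-- to block 1 before the joins, and block 2 is used for renaming both operands without clashes.
module ToExpr {k n : ℕ} (G : Graph n) where

  K = 3 * k

  abstract
    block : Fin 3 → Fin k → Fin K
    block = combine

    unblock : Fin K → Fin 3 × Fin k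
    unblock = remQuot k

    unblock-block : ∀ b i → unblock (block b i) ≡ (b , i)
    unblock-block = Fin.remQuot-combine

  block-inj : ∀ {b b′ i j} → block b i ≡ block b′ j → b ≡ b′ × i ≡ j
  block-inj eq = Product.,-injective (trans (≡-sym (unblock-block _ _)) (trans (cong unblock eq) (unblock-block _ _)))

  module Blocks (h : Fin 3 → Fin k → Fin 3 × Fin k)
    (idem : ∀ b i → uncurry h (h b i) ≡ h b i) where

    g : Fin K → Fin K
    g c = uncurry block (uncurry h (unblock c))

    g-block : ∀ b i → g (block b i) ≡ uncurry block (h b i)
    g-block b i = cong (uncurry block ∘ uncurry h) (unblock-block b i)

    g-idem : ∀ c → g (g c) ≡ g c
    g-idem c = trans (g-block _ _) (cong (uncurry block) (idem _ _))

    open Recolour g g-idem public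

    recolour-block : ∀ {m} (e : Expr K m) {x b i} → evalLab e x ≡ block b i →
      evalLab (recolour e) x ≡ uncurry block (h b i)
    recolour-block e eq = trans (recolour-lab e _) (trans (cong g eq) (g-block _ _))

  module Move (r : Fin 3 → Fin 3) (idem : ∀ b → r (r b) ≡ r b) =
    Blocks (λ b i → r b , i) (λ b i → cong (_, i) (idem b))

  pattern 0F = zero
  pattern 1F = suc zero
  pattern 2F = suc (suc zero)

  0to1 2to0 : Fin 3 → Fin 3
  0to1 0F = 1F
  0to1 1F = 1F
  0to1 2F = 2F
  2to0 0F = 0F
  2to0 1F = 1F
  2to0 2F = 0F

  0to1-idem : ∀ b → 0to1 (0to1 b) ≡ 0to1 b
  0to1-idem 0F = refl
  0to1-idem 1F = refl
  0to1-idem 2F = refl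

  2to0-idem : ∀ b → 2to0 (2to0 b) ≡ 2to0 b
  2to0-idem 0F = refl
  2to0-idem 1F = refl
  2to0-idem 2F = refl

  module To₁ = Move 0to1 0to1-idem
  module To₀ = Move 2to0 2to0-idem

  record Built (xs : List (Fin n)) (lab : Fin n → Fin k) : Set where
    field
      {size} : ℕ
      expr   : Expr K size
      φ      : Fin size → Fin n
      φ-inj  : Injective _≡_ _≡_ φ
      φ-∈    : ∀ x → φ x ∈ xs
      φ-onto : ∀ {v} → v ∈ xs → ∃ λ x → φ x ≡ v
      eval-adj : ∀ x y → evalAdj expr x y ≡ adj G (φ x) (φ y)
      eval-lab : ∀ x → evalLab expr x ≡ block 0F (lab (φ x))

  module Combine {xs ys f g lab} (dis : Disjoint xs ys) (cr : Cross G xs f ys g)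
    (r₁ : Refines xs f lab) (r₂ : Refines ys g lab) (A : Built xs f) (B : Built ys g) where

    module A = Built A
    module B = Built B
    m₁ = A.size
    m₂ = B.size

    e₂ = To₁.recolour B.expr
    u = union A.expr e₂

    φ : Fin (m₁ + m₂) → Fin n
    φ x = [ A.φ , B.φ ]′ (splitAt m₁ x)

    φ-ˡ : ∀ a → φ (a ↑ˡ m₂) ≡ A.φ a
    φ-ˡ a = cong [ A.φ , B.φ ]′ (Fin.splitAt-↑ˡ m₁ a m₂)

    φ-ʳ : ∀ b → φ (m₁ ↑ʳ b) ≡ B.φ b
    φ-ʳ b = cong [ A.φ , B.φ ]′ (Fin.splitAt-↑ʳ m₁ m₂ b)

    u-labˡ : ∀ a → evalLab u (a ↑ˡ m₂) ≡ block 0F (f (A.φ a))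
    u-labˡ a = trans (lab-union-ˡ A.expr e₂ a) (A.eval-lab a)

    u-labʳ : ∀ b → evalLab u (m₁ ↑ʳ b) ≡ block 1F (g (B.φ b))
    u-labʳ b = trans (lab-union-ʳ A.expr e₂ b) (To₁.recolour-block B.expr (B.eval-lab b))

    open Joins

    pairOf : Fin n × Fin n → Pair
    pairOf (x , y) = block 0F (f x) , block 1F (g y) , λ eq → case proj₁ (block-inj eq) of λ ()

    edge? : (xy : Fin n × Fin n) → Dec (adj G (proj₁ xy) (proj₂ xy) ≡ true)
    edge? (x , y) = adj G x y Bool.≟ true

    edges = filter edge? (cartesianProduct xs ys)
    ps = map pairOf edges
    j = joins ps u

    match⁻ : ∀ {a b} → Any (Matches a b) ps → ∃₂ λ x y → x ∈ xs × y ∈ ys × adj G x y ≡ true ×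
      Matches a b (pairOf (x , y))
    match⁻ h with find h
    ... | p , p∈ , M with ∈-map⁻ pairOf p∈
    ...   | (x , y) , xy∈ , refl =
      let (xy∈′ , e) = ∈-filter⁻ edge? {xs = cartesianProduct xs ys} xy∈
          (x∈ , y∈) = ∈-cartesianProduct⁻ xs ys xy∈′
      in x , y , x∈ , y∈ , e , M

    match⁺ : ∀ {x y a b} → x ∈ xs → y ∈ ys → adj G x y ≡ true → Matches a b (pairOf (x , y)) →
      Any (Matches a b) ps
    match⁺ x∈ y∈ e M = lose (∈-map⁺ pairOf (∈-filter⁺ edge? (∈-cartesianProduct⁺ x∈ y∈) e)) M

    -- Every added join is between a label of block 0 and one of block 1, so two vertices in the
    -- same block gain no edge.
    j-sameside : ∀ {x y c} → ∀ {i i′} → evalLab u x ≡ block c i → evalLab u y ≡ block c i′ →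
      evalAdj j x y ≡ evalAdj u x y
    j-sameside {x} {y} {c} lx ly = ⇔true⇒≡
      (λ h → case joins⁻ ps u h of λ where
        (inj₁ old) → old
        (inj₂ new) → case match⁻ new of λ where
          (_ , _ , _ , _ , _ , inj₁ (p , q)) → clash (block-inj (trans (≡-sym lx) p)) (block-inj (trans (≡-sym ly) q))
          (_ , _ , _ , _ , _ , inj₂ (p , q)) → clash (block-inj (trans (≡-sym ly) q)) (block-inj (trans (≡-sym lx) p)))
      (joins-old ps u)
      where
      clash : ∀ {A B C : Set} → c ≡ 0F × A → c ≡ 1F × B → C
      clash (refl , _) (() , _)

    -- The union has no edge here. An added join comes from an edge with the same pair of labels,
    -- and `Cross` carries it over to `a` and `b`.
    j-across : ∀ a b → evalAdj j (a ↑ˡ m₂) (m₁ ↑ʳ b) ≡ adj G (A.φ a) (B.φ b)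
    j-across a b = ⇔true⇒≡
      (λ h → case joins⁻ ps u h of λ where
        (inj₁ old) → ⊥-elim (false≢true (adj-union-ˡʳ A.expr e₂ a b) old)
        (inj₂ new) → case match⁻ new of λ where
          (x , y , x∈ , y∈ , e , inj₁ (p , q)) → trans (cr (A.φ-∈ a) x∈ (B.φ-∈ b) y∈
            (proj₂ (block-inj (trans (≡-sym (u-labˡ a)) p))) (proj₂ (block-inj (trans (≡-sym (u-labʳ b)) q)))) e
          (x , y , x∈ , y∈ , e , inj₂ (p , q)) → case proj₁ (block-inj (trans (≡-sym (u-labˡ a)) p)) of λ ())
      λ e → joins-new ps u (match⁺ (A.φ-∈ a) (B.φ-∈ b) e (inj₁ (u-labˡ a , u-labʳ b)))

    j-across′ : ∀ b a → evalAdj j (m₁ ↑ʳ b) (a ↑ˡ m₂) ≡ adj G (B.φ b) (A.φ a)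
    j-across′ b a = ⇔true⇒≡
      (λ h → case joins⁻ ps u h of λ where
        (inj₁ old) → ⊥-elim (false≢true (adj-union-ʳˡ A.expr e₂ b a) old)
        (inj₂ new) → case match⁻ new of λ where
          (x , y , x∈ , y∈ , e , inj₂ (p , q)) → trans (Graph.sym G _ _) (trans (cr (A.φ-∈ a) x∈ (B.φ-∈ b) y∈
            (proj₂ (block-inj (trans (≡-sym (u-labˡ a)) q))) (proj₂ (block-inj (trans (≡-sym (u-labʳ b)) p)))) e)
          (x , y , x∈ , y∈ , e , inj₁ (p , q)) → case proj₁ (block-inj (trans (≡-sym (u-labˡ a)) q)) of λ ())
      λ e → joins-new ps u (match⁺ (A.φ-∈ a) (B.φ-∈ b) (trans (Graph.sym G _ _) e) (inj₂ (u-labʳ b , u-labˡ a)))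

    -- The relabelling map whose existence `Refines` expresses, obtained by picking a vertex for
    -- each label that occurs.
    newLabel : List (Fin n) → (Fin n → Fin k) → Fin k → Fin k
    newLabel zs c i with Fin.any? (λ z → (z ∈? zs) ×-dec (c z ≟ i))
    ... | yes (z , _) = lab z
    ... | no _ = i

    newLabel≡ : ∀ {zs c} → Refines zs c lab → ∀ {z} → z ∈ zs → newLabel zs c (c z) ≡ lab z
    newLabel≡ {zs} {c} r {z} z∈ with Fin.any? (λ w → (w ∈? zs) ×-dec (c w ≟ c z))
    ... | yes (w , w∈ , eq) = r w∈ z∈ eq
    ... | no ¬w = contradiction (z , z∈ , refl) ¬w

    -- Block 2 is left fixed, so the map is idempotent whatever `newLabel` does; `To₀` then moves
    -- the outcome back to block 0.
    rename : Fin 3 → Fin k → Fin 3 × Fin k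
    rename 0F i = 2F , newLabel xs f i
    rename 1F i = 2F , newLabel ys g i
    rename 2F i = 2F , i

    rename-idem : ∀ b i → uncurry rename (rename b i) ≡ rename b i
    rename-idem 0F i = refl
    rename-idem 1F i = refl
    rename-idem 2F i = refl

    module Re = Blocks rename rename-idem

    result = To₀.recolour (Re.recolour j)

    result-adj : ∀ x y → evalAdj result x y ≡ evalAdj j x y
    result-adj x y = trans (To₀.recolour-adj (Re.recolour j) x y) (Re.recolour-adj j x y)

    result-lab : ∀ x → evalLab result x ≡ block 0F (lab (φ x))
    result-lab x with splitView m₁ x
    ... | inj₁ (a , refl) = trans
      (To₀.recolour-block (Re.recolour j) (Re.recolour-block j (trans (joins-lab ps u _) (u-labˡ a))))
      (cong (block 0F) (trans (newLabel≡ r₁ (A.φ-∈ a)) (cong lab (≡-sym (φ-ˡ a)))))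
    ... | inj₂ (b , refl) = trans
      (To₀.recolour-block (Re.recolour j) (Re.recolour-block j (trans (joins-lab ps u _) (u-labʳ b))))
      (cong (block 0F) (trans (newLabel≡ r₂ (B.φ-∈ b)) (cong lab (≡-sym (φ-ʳ b)))))

    j-adj : ∀ x y → evalAdj j x y ≡ adj G (φ x) (φ y)
    j-adj x y with splitView m₁ x | splitView m₁ y
    ... | inj₁ (a , refl) | inj₁ (a′ , refl) = trans (j-sameside (u-labˡ a) (u-labˡ a′))
      (trans (adj-union-ˡˡ A.expr e₂ a a′) (trans (A.eval-adj a a′) (≡-sym (cong₂ (adj G) (φ-ˡ a) (φ-ˡ a′)))))
    ... | inj₂ (b , refl) | inj₂ (b′ , refl) = trans (j-sameside (u-labʳ b) (u-labʳ b′))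
      (trans (adj-union-ʳʳ A.expr e₂ b b′) (trans (To₁.recolour-adj B.expr b b′)
        (trans (B.eval-adj b b′) (≡-sym (cong₂ (adj G) (φ-ʳ b) (φ-ʳ b′))))))
    ... | inj₁ (a , refl) | inj₂ (b , refl) = trans (j-across a b) (≡-sym (cong₂ (adj G) (φ-ˡ a) (φ-ʳ b)))
    ... | inj₂ (b , refl) | inj₁ (a , refl) = trans (j-across′ b a) (≡-sym (cong₂ (adj G) (φ-ʳ b) (φ-ˡ a)))

    φ-inj : Injective _≡_ _≡_ φ
    φ-inj {x} {y} eq with splitView m₁ x | splitView m₁ y
    ... | inj₁ (a , refl) | inj₁ (a′ , refl) = cong (_↑ˡ m₂) (A.φ-inj (trans (≡-sym (φ-ˡ a)) (trans eq (φ-ˡ a′))))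
    ... | inj₂ (b , refl) | inj₂ (b′ , refl) = cong (m₁ ↑ʳ_) (B.φ-inj (trans (≡-sym (φ-ʳ b)) (trans eq (φ-ʳ b′))))
    ... | inj₁ (a , refl) | inj₂ (b , refl) = ⊥-elim (dis (A.φ-∈ a)
      (subst (_∈ ys) (≡-sym (trans (≡-sym (φ-ˡ a)) (trans eq (φ-ʳ b)))) (B.φ-∈ b)))
    ... | inj₂ (b , refl) | inj₁ (a , refl) = ⊥-elim (dis (A.φ-∈ a)
      (subst (_∈ ys) (trans (≡-sym (φ-ʳ b)) (trans eq (φ-ˡ a))) (B.φ-∈ b)))

    φ-∈ : ∀ x → φ x ∈ xs ++ ys
    φ-∈ x with splitView m₁ x
    ... | inj₁ (a , refl) = ∈-++⁺ˡ (subst (_∈ xs) (≡-sym (φ-ˡ a)) (A.φ-∈ a))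
    ... | inj₂ (b , refl) = ∈-++⁺ʳ xs (subst (_∈ ys) (≡-sym (φ-ʳ b)) (B.φ-∈ b))

    φ-onto : ∀ {v} → v ∈ xs ++ ys → ∃ λ x → φ x ≡ v
    φ-onto v∈ with ∈-++⁻ xs v∈
    ... | inj₁ v∈₁ = let (a , eq) = A.φ-onto v∈₁ in a ↑ˡ m₂ , trans (φ-ˡ a) eq
    ... | inj₂ v∈₂ = let (b , eq) = B.φ-onto v∈₂ in m₁ ↑ʳ b , trans (φ-ʳ b) eq

    built : Built (xs ++ ys) lab
    built = record
      { expr = result ; φ = φ ; φ-inj = φ-inj ; φ-∈ = φ-∈ ; φ-onto = φ-onto
      ; eval-adj = λ x y → trans (result-adj x y) (j-adj x y) ; eval-lab = result-lab }

  build : ∀ {xs lab} → Decomp G k xs lab → Built xs lab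
  build nil = record
    { expr = empty ; φ = λ () ; φ-inj = λ { {()} } ; φ-∈ = λ () ; φ-onto = λ () ; eval-adj = λ () ; eval-lab = λ () }
  build {lab = lab} (leaf v) = record
    { expr = vertex (block 0F (lab v)) ; φ = λ _ → v ; φ-inj = λ { {zero} {zero} _ → refl }
    ; φ-∈ = λ _ → here refl ; φ-onto = λ { (here refl) → zero , refl }
    ; eval-adj = λ _ _ → ≡-sym (irref G v) ; eval-lab = λ _ → refl }
  build (node d e dis cr r₁ r₂) = Combine.built dis cr r₁ r₂ (build d) (build e)

Decomposable⇒CW : ∀ {k n} {G : Graph n} → Decomposable k G → CW≤ (3 * k) G
Decomposable⇒CW {k} {n} {G} (xs , lab , d , all∈) = toCW (↔⇒≡ π) π expr eval-adj
  where
  open ToExpr G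
  open Built (build d)
  π = permutation φ (λ v → proj₁ (φ-onto (all∈ v))) (λ v → proj₂ (φ-onto (all∈ v)))
        (λ x → φ-inj (proj₂ (φ-onto (all∈ (φ x)))))
  -- That the expression has exactly `n` vertices is known only because `φ` is a bijection.
  toCW : ∀ {s} → s ≡ n → (π : Permutation s n) (e : Expr (3 * k) s) →
    (∀ x y → evalAdj e x y ≡ adj G (π ⟨$⟩ʳ x) (π ⟨$⟩ʳ y)) → CW≤ (3 * k) G
  toCW refl π e h = e , π , λ x y → ≡-sym (h x y)

-- From decompositions to merge sequences

tag : Bool → ℕ → ℕ
tag true a = 2 * a
tag false a = suc (2 * a)

tag-injective : ∀ b b′ {a a′} → tag b a ≡ tag b′ a′ → b ≡ b′ × a ≡ a′
tag-injective true true eq = refl , ℕ.*-cancelˡ-≡ _ _ 2 eq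
tag-injective false false eq = refl , ℕ.*-cancelˡ-≡ _ _ 2 (ℕ.suc-injective eq)
tag-injective true false {a} {a′} eq = contradiction eq (ℕ.even≢odd a a′)
tag-injective false true {a} {a′} eq = contradiction (≡-sym eq) (ℕ.even≢odd a′ a)

-- A merge sequence on xs, not yet merging all parts: from step m on, the parts are given by lab.
record MergeSequence {n} (G : Graph n) (k : ℕ) (xs : List (Fin n)) (lab : Fin n → Fin k) : Set where
  field
    m      : ℕ
    P      : ℕ → Fin n → ℕ
    R      : ℕ → Fin n → Fin n → Bool
    first  : ∀ {x y} → x ∈ xs → y ∈ xs → P 0 x ≡ P 0 y → x ≡ y
    final  : ∀ {i x} → m ≤ i → x ∈ xs → P i x ≡ toℕ (lab x)
    labels : ∀ i {x y} → x ∈ xs → y ∈ xs → P i x ≡ P i y → lab x ≡ lab y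
    mono   : ∀ i {x y} → x ∈ xs → y ∈ xs → P i x ≡ P i y → P (suc i) x ≡ P (suc i) y
    R-∈    : ∀ i {x y} → R i x y ≡ true → x ∈ xs × y ∈ xs
    R-sym  : ∀ i x y → R i x y ≡ R i y x
    R-mono : ∀ i x y → R i x y ≡ true → R (suc i) x y ≡ true
    homog  : ∀ i {x y x′ y′} → x ∈ xs → y ∈ xs → x′ ∈ xs → y′ ∈ xs → P i x ≡ P i x′ → P i y ≡ P i y′ →
             x ≢ y → x′ ≢ y′ → R i x y ≡ false → R i x′ y′ ≡ false → adj G x y ≡ adj G x′ y′
    width  : ∀ i {v} → v ∈ xs → AtMostParts (k + k) (P i) (Ball∞ (R (suc i)) v)

module MergeUnion {n} {G : Graph n} {k xs ys f g lab} (dis : Disjoint xs ys) (cr : Cross G xs f ys g)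
  (r₁ : Refines xs f lab) (r₂ : Refines ys g lab)
  (A : MergeSequence G k xs f) (B : MergeSequence G k ys g) where

  module A = MergeSequence A
  module B = MergeSequence B

  zs = xs ++ ys
  M = A.m ⊔ B.m

  both : ℕ → Fin n → ℕ
  both i x = if ⌊ x ∈? xs ⌋ then tag true (A.P i x) else tag false (B.P i x)

  bothˡ : ∀ i {x} → x ∈ xs → both i x ≡ tag true (A.P i x)
  bothˡ i {x} x∈ with x ∈? xs
  ... | yes _ = refl
  ... | no x∉ = contradiction x∈ x∉

  bothʳ : ∀ i {x} → x ∈ ys → both i x ≡ tag false (B.P i x)
  bothʳ i {x} x∈ with x ∈? xs
  ... | yes x∈xs = ⊥-elim (dis x∈xs x∈)
  ... | no _ = refl

  both⁻ : ∀ i {x y} → x ∈ zs → y ∈ zs → both i x ≡ both i y →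
    (x ∈ xs × y ∈ xs × A.P i x ≡ A.P i y) ⊎ (x ∈ ys × y ∈ ys × B.P i x ≡ B.P i y)
  both⁻ i {x} {y} x∈ y∈ eq with ∈-++⁻ xs x∈ | ∈-++⁻ xs y∈
  ... | inj₁ p | inj₁ q = inj₁ (p , q , proj₂ (tag-injective true true
    (trans (≡-sym (bothˡ i p)) (trans eq (bothˡ i q)))))
  ... | inj₂ p | inj₂ q = inj₂ (p , q , proj₂ (tag-injective false false
    (trans (≡-sym (bothʳ i p)) (trans eq (bothʳ i q)))))
  ... | inj₁ p | inj₂ q = case proj₁ (tag-injective true false {A.P i x} {B.P i y}
    (trans (≡-sym (bothˡ i p)) (trans eq (bothʳ i q)))) of λ ()
  ... | inj₂ p | inj₁ q = case proj₁ (tag-injective false true {B.P i x} {A.P i y}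
    (trans (≡-sym (bothʳ i p)) (trans eq (bothˡ i q)))) of λ ()

  both-labels : ∀ i {x y} → x ∈ zs → y ∈ zs → both i x ≡ both i y → lab x ≡ lab y
  both-labels i x∈ y∈ eq with both⁻ i x∈ y∈ eq
  ... | inj₁ (p , q , e) = r₁ p q (A.labels i p q e)
  ... | inj₂ (p , q , e) = r₂ p q (B.labels i p q e)

  both-mono : ∀ i {x y} → x ∈ zs → y ∈ zs → both i x ≡ both i y → both (suc i) x ≡ both (suc i) y
  both-mono i x∈ y∈ eq with both⁻ i x∈ y∈ eq
  ... | inj₁ (p , q , e) = trans (bothˡ _ p) (trans (cong (tag true) (A.mono i p q e)) (≡-sym (bothˡ _ q)))
  ... | inj₂ (p , q , e) = trans (bothʳ _ p) (trans (cong (tag false) (B.mono i p q e)) (≡-sym (bothʳ _ q)))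

  bothR : ℕ → Fin n → Fin n → Bool
  bothR i x y = A.R i x y ∨ B.R i x y

  allR : Fin n → Fin n → Bool
  allR x y = ⌊ x ∈? zs ⌋ ∧ ⌊ y ∈? zs ⌋

  allR-true : ∀ {x y} → x ∈ zs → y ∈ zs → allR x y ≡ true
  allR-true x∈ y∈ = cong₂ _∧_ (true⇒⌊⌋ (_ ∈? zs) x∈) (true⇒⌊⌋ (_ ∈? zs) y∈)

  allR-∈ : ∀ {x y} → allR x y ≡ true → x ∈ zs × y ∈ zs
  allR-∈ {x} {y} e with x ∈? zs | y ∈? zs
  ... | yes p | yes q = p , q

  bothR-∈ : ∀ i {x y} → bothR i x y ≡ true → x ∈ zs × y ∈ zs
  bothR-∈ i {x} {y} e with ∨-true (A.R i x y) e
  ... | inj₁ a = let (p , q) = A.R-∈ i a in ∈-++⁺ˡ p , ∈-++⁺ˡ q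
  ... | inj₂ b = let (p , q) = B.R-∈ i b in ∈-++⁺ʳ xs p , ∈-++⁺ʳ xs q

  R : ℕ → Fin n → Fin n → Bool
  R i = if ⌊ i ℕ.≤? M ⌋ then bothR i else allR

  P : ℕ → Fin n → ℕ
  P i = if ⌊ i ℕ.≤? M ⌋ then both i else toℕ ∘ lab

  data Phase (i : ℕ) : Set where
    early : i ≤ M → P i ≡ both i → R i ≡ bothR i → Phase i
    late  : M < i → P i ≡ toℕ ∘ lab → R i ≡ allR → Phase i

  phase : ∀ i → Phase i
  phase i with i ℕ.≤? M in eq
  ... | yes p = early p (cong (λ d → if ⌊ d ⌋ then both i else toℕ ∘ lab) eq)
    (cong (λ d → if ⌊ d ⌋ then bothR i else allR) eq)
  ... | no p = late (ℕ.≰⇒> p) (cong (λ d → if ⌊ d ⌋ then both i else toℕ ∘ lab) eq)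
    (cong (λ d → if ⌊ d ⌋ then bothR i else allR) eq)

  homog : ∀ i {x y x′ y′} → x ∈ zs → y ∈ zs → x′ ∈ zs → y′ ∈ zs → P i x ≡ P i x′ → P i y ≡ P i y′ →
    x ≢ y → x′ ≢ y′ → R i x y ≡ false → R i x′ y′ ≡ false → adj G x y ≡ adj G x′ y′
  homog i {x} {y} {x′} {y′} x∈ y∈ x′∈ y′∈ ex ey ne ne′ r r′ with phase i
  ... | late _ _ eqR rewrite eqR = ⊥-elim (false≢true r (allR-true x∈ y∈))
  ... | early _ eqP eqR rewrite eqP | eqR with both⁻ i x∈ x′∈ ex | both⁻ i y∈ y′∈ ey
  ...   | inj₁ (p , p′ , e) | inj₁ (q , q′ , e′) = A.homog i p q p′ q′ e e′ ne ne′
            (Bool.∨-conicalˡ (A.R i x y) _ r) (Bool.∨-conicalˡ (A.R i x′ y′) _ r′)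
  ...   | inj₂ (p , p′ , e) | inj₂ (q , q′ , e′) = B.homog i p q p′ q′ e e′ ne ne′
            (Bool.∨-conicalʳ (A.R i x y) _ r) (Bool.∨-conicalʳ (A.R i x′ y′) _ r′)
  -- Pairs across never enter `bothR`; they are homogeneous anyway, because the parts of each child
  -- refine its labels.
  ...   | inj₁ (p , p′ , e) | inj₂ (q , q′ , e′) = cr p p′ q q′ (A.labels i p p′ e) (B.labels i q q′ e′)
  ...   | inj₂ (p , p′ , e) | inj₁ (q , q′ , e′) = trans (Graph.sym G x y)
            (trans (cr q q′ p p′ (A.labels i q q′ e′) (B.labels i p p′ e)) (Graph.sym G y′ x′))

  ballˡ : ∀ i {v y} → v ∈ xs → Ball∞ (bothR i) v y → y ∈ xs × Ball∞ (A.R i) v y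
  ballˡ i v∈ ε = v∈ , ε
  ballˡ i {v} v∈ (e ◅ es) with ∨-true (A.R i v _) e
  ... | inj₁ a = let (y∈ , es′) = ballˡ i (proj₂ (A.R-∈ i a)) es in y∈ , a ◅ es′
  ... | inj₂ b = ⊥-elim (dis v∈ (proj₁ (B.R-∈ i b)))

  ballʳ : ∀ i {v y} → v ∈ ys → Ball∞ (bothR i) v y → y ∈ ys × Ball∞ (B.R i) v y
  ballʳ i v∈ ε = v∈ , ε
  ballʳ i {v} v∈ (e ◅ es) with ∨-true (A.R i v _) e
  ... | inj₂ b = let (y∈ , es′) = ballʳ i (proj₂ (B.R-∈ i b)) es in y∈ , b ◅ es′
  ... | inj₁ a = ⊥-elim (dis (proj₁ (A.R-∈ i a)) v∈)

  ball-zs : ∀ {v y} → v ∈ zs → Ball∞ allR v y → y ∈ zs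
  ball-zs = stays (λ _ e → proj₂ (allR-∈ e))

  -- Up to `M` the balls stay inside one child, and after `M` the parts are the `k` labels of the
  -- node. Only the step leaving `M` mixes the children; by then each has reached its final labels,
  -- which gives `k + k`.
  width : ∀ i {v} → v ∈ zs → AtMostParts (k + k) (P i) (Ball∞ (R (suc i)) v)
  width i {v} v∈ with phase i | phase (suc i)
  ... | late lt eqP _ | early le _ _ = ⊥-elim (ℕ.<-irrefl refl (ℕ.<-trans lt le))
  ... | early _ eqP _ | early _ _ eqR rewrite eqP | eqR with ∈-++⁻ xs v∈
  ...   | inj₁ p = let (h , c) = A.width i p in tag true ∘ h , λ y ball →
            let (y∈ , ball′) = ballˡ (suc i) p ball ; (j , e) = c y ball′
            in j , trans (bothˡ i y∈) (cong (tag true) e)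
  ...   | inj₂ p = let (h , c) = B.width i p in tag false ∘ h , λ y ball →
            let (y∈ , ball′) = ballʳ (suc i) p ball ; (j , e) = c y ball′
            in j , trans (bothʳ i y∈) (cong (tag false) e)
  width i {v} v∈ | late _ eqP _ | late _ _ eqR rewrite eqP | eqR =
    [ toℕ , toℕ ]′ ∘ splitAt k , λ y _ → lab y ↑ˡ k , ≡-sym (cong [ toℕ , toℕ ]′ (Fin.splitAt-↑ˡ k (lab y) k))
  width i {v} v∈ | early le eqP _ | late lt _ eqR rewrite eqP | eqR = value ∘ splitAt k , covers
    where
    i≡M : M ≡ i
    i≡M = ℕ.≤-antisym (s≤s⁻¹ lt) le
    value : Fin k ⊎ Fin k → ℕ
    value = [ tag true ∘ toℕ , tag false ∘ toℕ ]′
    covers : ∀ y → Ball∞ allR v y → ∃ λ j → both i y ≡ value (splitAt k j)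
    covers y ball with ∈-++⁻ xs (ball-zs v∈ ball)
    ... | inj₁ y∈ = f y ↑ˡ k , trans (bothˡ i y∈) (trans
      (cong (tag true) (A.final (subst (A.m ≤_) i≡M (ℕ.m≤m⊔n A.m B.m)) y∈))
      (≡-sym (cong value (Fin.splitAt-↑ˡ k (f y) k))))
    ... | inj₂ y∈ = k ↑ʳ g y , trans (bothʳ i y∈) (trans
      (cong (tag false) (B.final (subst (B.m ≤_) i≡M (ℕ.m≤n⊔m A.m B.m)) y∈))
      (≡-sym (cong value (Fin.splitAt-↑ʳ k k (g y)))))

  sequence : MergeSequence G k zs lab
  sequence = record
    { m = suc M ; P = P ; R = R ; first = first ; final = final ; labels = labels ; mono = mono
    ; R-∈ = R-∈ ; R-sym = R-sym ; R-mono = R-mono ; homog = homog ; width = width }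
    where
    first : ∀ {x y} → x ∈ zs → y ∈ zs → P 0 x ≡ P 0 y → x ≡ y
    first x∈ y∈ e with both⁻ 0 x∈ y∈ e
    ... | inj₁ (p , q , e′) = A.first p q e′
    ... | inj₂ (p , q , e′) = B.first p q e′
    final : ∀ {i x} → suc M ≤ i → x ∈ zs → P i x ≡ toℕ (lab x)
    final {i} {x} lt _ with phase i
    ... | early le _ _ = ⊥-elim (ℕ.<⇒≱ lt le)
    ... | late _ eqP _ = cong (λ h → h x) eqP
    labels : ∀ i {x y} → x ∈ zs → y ∈ zs → P i x ≡ P i y → lab x ≡ lab y
    labels i x∈ y∈ e with phase i
    ... | early _ eqP _ rewrite eqP = both-labels i x∈ y∈ e
    ... | late _ eqP _ rewrite eqP = Fin.toℕ-injective e
    mono : ∀ i {x y} → x ∈ zs → y ∈ zs → P i x ≡ P i y → P (suc i) x ≡ P (suc i) y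
    mono i x∈ y∈ e with phase (suc i)
    ... | late _ eqP′ _ rewrite eqP′ = cong toℕ (labels i x∈ y∈ e)
    ... | early le eqP′ _ with phase i
    ...   | early _ eqP _ rewrite eqP | eqP′ = both-mono i x∈ y∈ e
    ...   | late lt _ _ = ⊥-elim (ℕ.<-irrefl refl (ℕ.<-trans lt le))
    R-∈ : ∀ i {x y} → R i x y ≡ true → x ∈ zs × y ∈ zs
    R-∈ i e with phase i
    ... | early _ _ eqR rewrite eqR = bothR-∈ i e
    ... | late _ _ eqR rewrite eqR = allR-∈ e
    R-sym : ∀ i x y → R i x y ≡ R i y x
    R-sym i x y with phase i
    ... | early _ _ eqR rewrite eqR = cong₂ _∨_ (A.R-sym i x y) (B.R-sym i x y)
    ... | late _ _ eqR rewrite eqR = Bool.∧-comm ⌊ x ∈? zs ⌋ ⌊ y ∈? zs ⌋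
    R-mono : ∀ i x y → R i x y ≡ true → R (suc i) x y ≡ true
    R-mono i x y e with phase (suc i)
    ... | late _ _ eqR′ rewrite eqR′ = let (p , q) = R-∈ i e in allR-true p q
    ... | early le _ eqR′ with phase i
    ...   | late lt _ _ = ⊥-elim (ℕ.<-irrefl refl (ℕ.<-trans lt le))
    ...   | early _ _ eqR rewrite eqR | eqR′ with ∨-true (A.R i x y) e
    ...     | inj₁ a = ∨-trueˡ _ (A.R-mono i x y a)
    ...     | inj₂ b = ∨-trueʳ (A.R (suc i) x y) (B.R-mono i x y b)

mergeSequence : ∀ {n} {G : Graph n} {k xs lab} → Decomp G k xs lab → MergeSequence G k xs lab
mergeSequence {lab = lab} nil = record
  { m = 0 ; P = λ _ → toℕ ∘ lab ; R = λ _ _ _ → false ; first = λ () ; final = λ _ _ → refl ; labels = λ _ ()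
  ; mono = λ _ () ; R-∈ = λ _ () ; R-sym = λ _ _ _ → refl ; R-mono = λ _ _ _ () ; homog = λ _ () ; width = λ _ () }
mergeSequence {k = k} {lab = lab} (leaf v) = record
  { m = 0 ; P = λ _ → toℕ ∘ lab ; R = λ _ _ _ → false
  ; first = λ { (here refl) (here refl) _ → refl } ; final = λ _ _ → refl
  ; labels = λ _ _ _ → Fin.toℕ-injective ; mono = λ _ _ _ → id
  ; R-∈ = λ _ () ; R-sym = λ _ _ _ → refl ; R-mono = λ _ _ _ ()
  ; homog = λ { _ (here refl) (here refl) _ _ _ _ ne _ _ _ → contradiction refl ne }
  ; width = λ _ _ → [ toℕ , toℕ ]′ ∘ splitAt k , λ y _ →
      lab y ↑ˡ k , ≡-sym (cong [ toℕ , toℕ ]′ (Fin.splitAt-↑ˡ k (lab y) k)) }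
mergeSequence (node d e dis cr r₁ r₂) = MergeUnion.sequence dis cr r₁ r₂ (mergeSequence d) (mergeSequence e)

Decomposable⇒MW : ∀ {k n} {G : Graph n} → Decomposable k G → MW∞≤ (k + k) G
Decomposable⇒MW {k} {n} {G} (xs , lab , d , all∈) = record
  -- A last step merges the labels of the root into one part.
  { m = suc m ; P = P′ ; R = R′
  ; first = λ x y → first (all∈ x) (all∈ y)
  ; last = last
  ; mono = mono′
  ; Rsym = Rsym
  ; Rmono = Rmono
  ; homog = homog′
  ; width = width′ }
  where
  open MergeSequence (mergeSequence d)
  P′ : ℕ → Fin n → ℕ
  P′ i = if ⌊ i ℕ.≤? m ⌋ then P i else λ _ → 0
  R′ : ℕ → Fin n → Fin n → Bool
  R′ i = if ⌊ i ℕ.≤? m ⌋ then R i else λ _ _ → true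
  last : Whole (P′ (suc m))
  last x y with suc m ℕ.≤? m
  ... | yes p = ⊥-elim (ℕ.<-irrefl refl p)
  ... | no _ = refl
  mono′ : ∀ i → i < suc m → P′ i ⪯ P′ (suc i)
  mono′ i lt x y e with suc i ℕ.≤? m | i ℕ.≤? m
  ... | yes p | yes q = mono i (all∈ x) (all∈ y) e
  ... | yes p | no q = contradiction (ℕ.<⇒≤ p) q
  ... | no _ | _ = refl
  Rsym : ∀ i x y → R′ i x y ≡ R′ i y x
  Rsym i x y with i ℕ.≤? m
  ... | yes _ = R-sym i x y
  ... | no _ = refl
  Rmono : ∀ i → i < suc m → ∀ x y → R′ i x y ≡ true → R′ (suc i) x y ≡ true
  Rmono i lt x y e with suc i ℕ.≤? m | i ℕ.≤? m
  ... | yes p | yes q = R-mono i x y e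
  ... | yes p | no q = contradiction (ℕ.<⇒≤ p) q
  ... | no _ | _ = refl
  homog′ : ∀ i → i ≤ suc m → Homogeneous G (P′ i) (R′ i)
  homog′ i _ x y x′ y′ with i ℕ.≤? m
  ... | yes _ = homog i (all∈ x) (all∈ y) (all∈ x′) (all∈ y′)
  ... | no _ = λ _ _ _ _ ()
  width′ : ∀ i → i < suc m → ∀ v → AtMostParts (k + k) (P′ i) (Ball∞ (R′ (suc i)) v)
  width′ i lt v with i ℕ.≤? m | suc i ℕ.≤? m
  ... | no q | _ = contradiction (s≤s⁻¹ lt) q
  ... | yes p | yes q = width i (all∈ v)
  ... | yes p | no q = [ toℕ , toℕ ]′ ∘ splitAt k , λ y _ → lab y ↑ˡ k ,
    trans (final (s≤s⁻¹ (ℕ.≰⇒> q)) (all∈ y)) (≡-sym (cong [ toℕ , toℕ ]′ (Fin.splitAt-↑ˡ k (lab y) k)))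

-- Small dominating sets

thin : ∀ {A : Set} {N} (key : A → Fin N) (xs : List A) → ∃ λ ys → length ys ≤ N ×
  (∀ {y} → y ∈ ys → y ∈ xs) × (∀ {x} → x ∈ xs → ∃ λ y → y ∈ ys × key y ≡ key x)
thin {A} {N} key xs =
  let (ys , len , sub , hit) = pick (allFin N)
  in ys , subst (length ys ≤_) (length-tabulate id) len , sub , λ x∈ → hit (∈-allFin _) x∈ refl
  where
  pick : ∀ is → ∃ λ ys → length ys ≤ length is × (∀ {y} → y ∈ ys → y ∈ xs) ×
    (∀ {i x} → i ∈ is → x ∈ xs → key x ≡ i → ∃ λ y → y ∈ ys × key y ≡ key x)
  pick [] = [] , z≤n , (λ ()) , λ ()
  pick (i ∷ is) with pick is | Any.any? (λ x → key x ≟ i) xs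
  ... | ys , len , sub , hit | no none = ys , ℕ.m≤n⇒m≤1+n len , sub , λ where
    (here refl) x∈ e → contradiction (lose x∈ e) none
    (there i∈) x∈ e → hit i∈ x∈ e
  ... | ys , len , sub , hit | yes some =
    let (x , x∈ , e) = find some in
    x ∷ ys , s≤s len , (λ { (here refl) → x∈ ; (there y∈) → sub y∈ }) , λ where
      (here refl) z∈ e′ → x , here refl , trans e (≡-sym e′)
      (there i∈) z∈ e′ → let (y , y∈ , e″) = hit i∈ z∈ e′ in y , there y∈ , e″

module _ {n : ℕ} (G : Graph n) where

  Twin : ∀ {k} → List (Fin n) → (Fin n → Fin k) → Set
  Twin xs f = ∀ {x x′ y} → x ∈ xs → x′ ∈ xs → y ∉ xs → f x ≡ f x′ → adj G x y ≡ adj G x′ y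

  ++-∉ : ∀ {xs ys : List (Fin n)} {y} → y ∉ xs → y ∉ ys → y ∉ xs ++ ys
  ++-∉ {xs} y∉xs y∉ys y∈ = [ y∉xs , y∉ys ]′ (∈-++⁻ xs y∈)

  module _ {k xs ys} {f g lab : Fin n → Fin k} (cr : Cross G xs f ys g) (tw : Twin (xs ++ ys) lab) where

    -- A vertex outside `xs` lies in the sibling, where `Cross` applies, or outside the parent,
    -- where equal labels at the child remain equal.
    Twin-ˡ : Refines xs f lab → Twin xs f
    Twin-ˡ r {y = y} x∈ x′∈ y∉ e with y ∈? ys
    ... | yes y∈ = cr x∈ x′∈ y∈ y∈ e refl
    ... | no y∉ys = tw (∈-++⁺ˡ x∈) (∈-++⁺ˡ x′∈) (++-∉ y∉ y∉ys) (r x∈ x′∈ e)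

    Twin-ʳ : Refines ys g lab → Twin ys g
    Twin-ʳ r {y = y} x∈ x′∈ y∉ e with y ∈? xs
    ... | yes y∈ = trans (Graph.sym G _ _) (trans (cr y∈ y∈ x∈ x′∈ refl e) (Graph.sym G _ _))
    ... | no y∉xs = tw (∈-++⁺ʳ xs x∈) (∈-++⁺ʳ xs x′∈) (++-∉ y∉xs y∉) (r x∈ x′∈ e)

-- One descends in the tree as long as L ∩ Z and R ∩ Z suffice to dominate the vertices of R and L
-- outside the current node Z; where this stops, the vertices blocking it do the rest.
module Domination {n : ℕ} (G : Graph n) {k : ℕ} (xs : List (Fin n)) where

  Dominated : Bool → (L R : Pred (Fin n) 0ℓ) → Set
  Dominated b L R = ∃ λ T → length T ≤ 2 + k × (∀ {t} → t ∈ T → t ∈ xs × L t) ×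
    (∀ {r} → r ∈ xs → R r → ∃ λ t → t ∈ T × adj G r t ≡ b)

  Serves : Bool → (L R : Pred (Fin n) 0ℓ) → List (Fin n) → Set
  Serves b L R zs = ∀ {r} → r ∈ xs → R r → r ∉ zs → ∃ λ l → l ∈ zs × L l × adj G r l ≡ b

  Blocker : Bool → (L R : Pred (Fin n) 0ℓ) → List (Fin n) → Set
  Blocker b L R zs = ∃ λ r → r ∈ xs × R r × r ∉ zs × (∀ l → l ∈ zs → L l → adj G r l ≡ not b)

  serves? : ∀ b {L R} → Decidable L → Decidable R → ∀ zs → Serves b L R zs ⊎ Blocker b L R zs
  serves? b {L} {R} L? R? zs with Fin.any? (λ r → (r ∈? xs) ×-dec R? r ×-dec ¬? (r ∈? zs) ×-dec
                              Fin.all? (λ l → (l ∈? zs) →-dec (L? l →-dec (adj G r l Bool.≟ not b))))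
  ... | yes blocker = inj₂ blocker
  ... | no none = inj₁ serve
    where
    serve : Serves b L R zs
    serve {r} r∈ Rr r∉ with Fin.any? (λ l → (l ∈? zs) ×-dec L? l ×-dec (adj G r l Bool.≟ b))
    ... | yes found = found
    ... | no ¬found = contradiction
      (r , r∈ , Rr , r∉ , λ l l∈ Ll → Bool.¬-not (λ e → ¬found (l , l∈ , Ll , e))) none

  module _ {zs} {f : Fin n → Fin k} (zs⊆ : ∀ {z} → z ∈ zs → z ∈ xs) (tw : Twin G zs f) where

    -- To a vertex outside `zs` the members of `zs` with one label look alike, so one vertex of `L`
    -- per label serves as well as all of them.
    reps : ∀ b {L R} → Decidable L → Serves b L R zs → ∃ λ T → length T ≤ k ×
      (∀ {t} → t ∈ T → t ∈ xs × L t) × (∀ {r} → r ∈ xs → R r → r ∉ zs → ∃ λ t → t ∈ T × adj G r t ≡ b)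
    reps b L? serve =
      let (T , len , sub , hit) = thin f (filter L? zs)
      in T , len , (λ t∈ → let (t∈zs , Lt) = ∈-filter⁻ L? (sub t∈) in zs⊆ t∈zs , Lt) , λ r∈ Rr r∉ →
        let (l , l∈ , Ll , e) = serve r∈ Rr r∉
            (t , t∈ , e′) = hit (∈-filter⁺ L? l∈ Ll)
        in t , t∈ , trans (Graph.sym G _ _) (trans (tw (proj₁ (∈-filter⁻ L? (sub t∈))) l∈ r∉ e′)
             (trans (Graph.sym G _ _) e))

    -- A blocker for the opposite direction dominates zs itself.
    mixed : ∀ b {L R} → Decidable L → Serves b L R zs → Blocker (not b) R L zs → Dominated b L R
    mixed b {L} {R} L? serve (l , l∈ , Ll , l∉ , all) =
      let (T , len , sub , hit) = reps b L? serve
      in l ∷ T , s≤s (ℕ.m≤n⇒m≤1+n len) , (λ { (here refl) → l∈ , Ll ; (there t∈) → sub t∈ }) , dom T hit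
      where
      dom : ∀ T → (∀ {r} → r ∈ xs → R r → r ∉ zs → ∃ λ t → t ∈ T × adj G r t ≡ b) →
        ∀ {r} → r ∈ xs → R r → ∃ λ t → t ∈ l ∷ T × adj G r t ≡ b
      dom T hit {r} r∈ Rr with r ∈? zs
      ... | yes r∈zs = l , here refl , trans (Graph.sym G r l) (trans (all r r∈zs Rr) (Bool.not-involutive b))
      ... | no r∉ = let (t , t∈ , e) = hit r∈ Rr r∉ in t , there t∈ , e

  -- Each blocker dominates one of the two halves and `reps` takes care of everything outside; this
  -- is where the size `2 + k` comes from.
  blocked : ∀ {as bs} {f : Fin n → Fin k} (zs⊆ : ∀ {z} → z ∈ as ++ bs → z ∈ xs) → Twin G (as ++ bs) f →
    ∀ b {L R} → Decidable L → Serves b L R (as ++ bs) →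
    Blocker (not b) R L as → Blocker (not b) R L bs → Dominated b L R
  blocked {as} {bs} zs⊆ tw b {L} {R} L? serve (l , l∈ , Ll , _ , all) (l′ , l′∈ , Ll′ , _ , all′) =
    let (T , len , sub , hit) = reps zs⊆ tw b L? serve
    in l ∷ l′ ∷ T , s≤s (s≤s len) ,
       (λ { (here refl) → l∈ , Ll ; (there (here refl)) → l′∈ , Ll′ ; (there (there t∈)) → sub t∈ }) , dom T hit
    where
    dom : ∀ T → (∀ {r} → r ∈ xs → R r → r ∉ as ++ bs → ∃ λ t → t ∈ T × adj G r t ≡ b) →
      ∀ {r} → r ∈ xs → R r → ∃ λ t → t ∈ l ∷ l′ ∷ T × adj G r t ≡ b
    dom T hit {r} r∈ Rr with r ∈? as | r ∈? bs
    ... | yes p | _ = l , here refl , trans (Graph.sym G r l) (trans (all r p Rr) (Bool.not-involutive b))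
    ... | no _ | yes p = l′ , there (here refl) , trans (Graph.sym G r l′) (trans (all′ r p Rr) (Bool.not-involutive b))
    ... | no p | no q = let (t , t∈ , e) = hit r∈ Rr (++-∉ G p q) in t , there (there t∈) , e

  module _ {L R : Pred (Fin n) 0ℓ} (L? : Decidable L) (R? : Decidable R) where

    descend : ∀ {zs f} → Decomp G k zs f → (∀ {z} → z ∈ zs → z ∈ xs) → Twin G zs f →
      Serves false L R zs → Serves true R L zs → Dominated false L R ⊎ Dominated true R L
    -- An empty node cannot serve any vertex, so `R` has none in `xs`.
    descend nil zs⊆ tw s₁ s₂ = inj₁ ([] , z≤n , (λ ()) , λ r∈ Rr → case s₁ r∈ Rr (λ ()) of λ ())
    descend (leaf v) zs⊆ tw s₁ s₂ with L? v | R? v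
    ... | yes Lv | _ = inj₁ (v ∷ [] , s≤s z≤n , (λ { (here refl) → zs⊆ (here refl) , Lv }) , dom)
      where
      dom : ∀ {r} → r ∈ xs → R r → ∃ λ t → t ∈ v ∷ [] × adj G r t ≡ false
      dom {r} r∈ Rr with r ≟ v
      -- A vertex is a non-neighbour of itself, so `v` also dominates itself.
      ... | yes refl = v , here refl , irref G v
      ... | no r≢v with s₁ r∈ Rr (λ { (here eq) → r≢v eq })
      ...   | l , here refl , _ , e = l , here refl , e
    ... | no ¬Lv | yes Rv = inj₂ (v ∷ [] , s≤s z≤n , (λ { (here refl) → zs⊆ (here refl) , Rv }) , dom)
      where
      dom : ∀ {l} → l ∈ xs → L l → ∃ λ t → t ∈ v ∷ [] × adj G l t ≡ true
      dom {l} l∈ Ll with s₂ l∈ Ll (λ { (here refl) → ¬Lv Ll })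
      ... | r , here refl , _ , e = r , here refl , e
    ... | no ¬Lv | no ¬Rv = inj₁ ([] , z≤n , (λ ()) , λ r∈ Rr →
            case s₁ r∈ Rr (λ { (here refl) → ¬Rv Rr }) of λ where
              (_ , here refl , Ll , _) → contradiction Ll ¬Lv)
    descend (node {as} {bs} d e dis cr r₁ r₂) zs⊆ tw s₁ s₂
      with serves? false L? R? as | serves? true R? L? as | serves? false L? R? bs | serves? true R? L? bs
    ... | inj₁ p | inj₁ q | _ | _ = descend d (zs⊆ ∘ ∈-++⁺ˡ) (Twin-ˡ G cr tw r₁) p q
    ... | inj₁ p | inj₂ q | _ | _ = inj₁ (mixed (zs⊆ ∘ ∈-++⁺ˡ) (Twin-ˡ G cr tw r₁) false L? p q)
    ... | inj₂ p | inj₁ q | _ | _ = inj₂ (mixed (zs⊆ ∘ ∈-++⁺ˡ) (Twin-ˡ G cr tw r₁) true R? q p)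
    ... | _ | _ | inj₁ p | inj₁ q = descend e (zs⊆ ∘ ∈-++⁺ʳ as) (Twin-ʳ G cr tw r₂) p q
    ... | _ | _ | inj₁ p | inj₂ q = inj₁ (mixed (zs⊆ ∘ ∈-++⁺ʳ as) (Twin-ʳ G cr tw r₂) false L? p q)
    ... | _ | _ | inj₂ p | inj₁ q = inj₂ (mixed (zs⊆ ∘ ∈-++⁺ʳ as) (Twin-ʳ G cr tw r₂) true R? q p)
    -- Both children are blocked in both directions; for each of them some vertex of `L` is
    -- non-adjacent to all its vertices in `R`.
    ... | _ | inj₂ q | inj₂ _ | inj₂ q′ = inj₁ (blocked zs⊆ tw false L? s₁ q q′)

    dominate : ∀ {f} → Decomp G k xs f → Twin G xs f → Dominated false L R ⊎ Dominated true R L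
    -- At the start no vertex of `xs` lies outside the node, so both conditions hold vacuously.
    dominate d tw = descend d id tw (λ r∈ _ r∉ → contradiction r∈ r∉) (λ r∈ _ r∉ → contradiction r∈ r∉)

-- Bounded hereditary sets of marks

bits : ∀ {m} → (Fin m → Bool) → Fin (2 ^ m)
bits b = funToFin (λ i → if b i then suc zero else zero)

bits-injective : ∀ {m} {b b′ : Fin m → Bool} → bits b ≡ bits b′ → ∀ i → b i ≡ b′ i
bits-injective {b = b} {b′} e i = bit (b i) (b′ i) (trans (≡-sym (Fin.finToFun-funToFin _ i))
    (trans (cong (λ c → finToFun c i) e) (Fin.finToFun-funToFin _ i)))
  where
  bit : ∀ x y → (if x then suc zero else zero) ≡ (if y then suc {1} zero else zero) → x ≡ y
  bit true true _ = refl
  bit false false _ = refl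
  bit true false ()
  bit false true ()

length-concat≤ : ∀ {A : Set} {c} (xss : List (List A)) → (∀ {xs} → xs ∈ xss → length xs ≤ c) →
  length (concat xss) ≤ length xss * c
length-concat≤ [] _ = z≤n
length-concat≤ (xs ∷ xss) h = ℕ.≤-trans (ℕ.≤-reflexive (length-++ xs))
  (ℕ.+-mono-≤ (h (here refl)) (length-concat≤ xss (h ∘ there)))

length-split : ∀ {A : Set} {P : Pred A 0ℓ} (P? : Decidable P) xs →
  length (filter P? xs) + length (filter (¬? ∘ P?) xs) ≡ length xs
length-split P? [] = refl
length-split P? (x ∷ xs) with P? x
... | yes _ = cong suc (length-split P? xs)
... | no _ = trans (ℕ.+-suc _ _) (cong suc (length-split P? xs))

-- One list per key: its length, the labels occurring in it, and for each of the two adjacency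
-- values the labels with an undominated vertex. The outer `suc` makes room for the two lists of a
-- leaf.
menuSize : ℕ → ℕ → ℕ
menuSize k c = suc (suc c * (2 ^ k * (2 ^ k * 2 ^ k)))

module _ {n : ℕ} (G : Graph n) where

  Undominated : Bool → Fin n → List (Fin n) → Set
  Undominated b a X = ∀ {x} → x ∈ X → adj G a x ≢ b

  -- Seen from outside zs, Y can replace X: it has the same labels, and the vertices of zs it fails
  -- to dominate have no other labels than those X fails to dominate.
  record Simulates {k} (zs : List (Fin n)) (lab : Fin n → Fin k) (X Y : List (Fin n)) : Set where
    field
      back  : ∀ {y} → y ∈ Y → ∃ λ x → x ∈ X × lab x ≡ lab y
      forth : ∀ {x} → x ∈ X → ∃ λ y → y ∈ Y × lab y ≡ lab x
      undom : ∀ b {a} → a ∈ zs → Undominated b a Y → ∃ λ a′ → a′ ∈ zs × lab a′ ≡ lab a × Undominated b a′ X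
  open Simulates

  simulates-trans : ∀ {k zs} {lab : Fin n → Fin k} {X Y Z} →
    Simulates zs lab X Y → Simulates zs lab Y Z → Simulates zs lab X Z
  simulates-trans s t .back z∈ = let (y , y∈ , e) = t .back z∈ ; (x , x∈ , e′) = s .back y∈ in x , x∈ , trans e′ e
  simulates-trans s t .forth x∈ = let (y , y∈ , e) = s .forth x∈ ; (z , z∈ , e′) = t .forth y∈ in z , z∈ , trans e′ e
  simulates-trans s t .undom b a∈ u =
    let (a′ , a′∈ , e , u′) = t .undom b a∈ u ; (a″ , a″∈ , e′ , u″) = s .undom b a′∈ u′
    in a″ , a″∈ , trans e′ e , u″

  -- Let `a` in `xs` be undominated by `Y₁` and `Y₂`. The simulation in `xs` replaces it by some
  -- `a′` undominated by `X₁`. A vertex of `X₂` dominating `a′` would by `Cross` yield a vertex of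
  -- `Y₂` with the same label dominating `a`.
  simulates-++ : ∀ {k xs ys} {f g lab : Fin n → Fin k} → Cross G xs f ys g →
    Refines xs f lab → Refines ys g lab → ∀ {X X₁ X₂ Y₁ Y₂} →
    (∀ {x} → x ∈ X₁ → x ∈ xs) → (∀ {x} → x ∈ X₂ → x ∈ ys) →
    (∀ {x} → x ∈ Y₁ → x ∈ xs) → (∀ {x} → x ∈ Y₂ → x ∈ ys) →
    (∀ {x} → x ∈ X₁ → x ∈ X) → (∀ {x} → x ∈ X₂ → x ∈ X) → (∀ {x} → x ∈ X → x ∈ X₁ ⊎ x ∈ X₂) →
    Simulates xs f X₁ Y₁ → Simulates ys g X₂ Y₂ → Simulates (xs ++ ys) lab X (Y₁ ++ Y₂)
  simulates-++ {xs = xs} {ys} {f} {g} {lab} cr r₁ r₂ {X} {X₁} {X₂} {Y₁} {Y₂} X₁⊆ X₂⊆ Y₁⊆ Y₂⊆ X₁⊆X X₂⊆X X⊆ s t =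
    record { back = bk ; forth = fo ; undom = un }
    where
    bk : ∀ {y} → y ∈ Y₁ ++ Y₂ → ∃ λ x → x ∈ X × lab x ≡ lab y
    bk y∈ with ∈-++⁻ Y₁ y∈
    ... | inj₁ p = let (x , x∈ , e) = s .back p in x , X₁⊆X x∈ , r₁ (X₁⊆ x∈) (Y₁⊆ p) e
    ... | inj₂ p = let (x , x∈ , e) = t .back p in x , X₂⊆X x∈ , r₂ (X₂⊆ x∈) (Y₂⊆ p) e
    fo : ∀ {x} → x ∈ X → ∃ λ y → y ∈ Y₁ ++ Y₂ × lab y ≡ lab x
    fo x∈ with X⊆ x∈
    ... | inj₁ p = let (y , y∈ , e) = s .forth p in y , ∈-++⁺ˡ y∈ , r₁ (Y₁⊆ y∈) (X₁⊆ p) e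
    ... | inj₂ p = let (y , y∈ , e) = t .forth p in y , ∈-++⁺ʳ Y₁ y∈ , r₂ (Y₂⊆ y∈) (X₂⊆ p) e
    un : ∀ b {a} → a ∈ xs ++ ys → Undominated b a (Y₁ ++ Y₂) →
      ∃ λ a′ → a′ ∈ xs ++ ys × lab a′ ≡ lab a × Undominated b a′ X
    un b {a} a∈ u with ∈-++⁻ xs a∈
    ... | inj₁ p = let (a′ , a′∈ , e , u′) = s .undom b p (u ∘ ∈-++⁺ˡ) in
          a′ , ∈-++⁺ˡ a′∈ , r₁ a′∈ p e , λ x∈ → [ u′ , across a′∈ e ]′ (X⊆ x∈)
      where
      across : ∀ {a′} → a′ ∈ xs → f a′ ≡ f a → Undominated b a′ X₂
      across a′∈ e x∈ eq = let (y , y∈ , e′) = t .forth x∈ in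
        u (∈-++⁺ʳ Y₁ y∈) (trans (cr p a′∈ (Y₂⊆ y∈) (X₂⊆ x∈) (≡-sym e) e′) eq)
    ... | inj₂ p = let (a′ , a′∈ , e , u′) = t .undom b p (u ∘ ∈-++⁺ʳ Y₁) in
          a′ , ∈-++⁺ʳ xs a′∈ , r₂ a′∈ p e , λ x∈ → [ across a′∈ e , u′ ]′ (X⊆ x∈)
      where
      across : ∀ {a′} → a′ ∈ ys → g a′ ≡ g a → Undominated b a′ X₁
      across a′∈ e x∈ eq = let (y , y∈ , e′) = s .forth x∈ in
        u (∈-++⁺ˡ y∈) (trans (Graph.sym G _ _) (trans (cr (Y₁⊆ y∈) (X₁⊆ x∈) p a′∈ e′ (≡-sym e))
          (trans (Graph.sym G _ _) eq)))

  module Profile {k : ℕ} (c : ℕ) (zs : List (Fin n)) (lab : Fin n → Fin k) where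

    Size : ℕ
    Size = suc c * (2 ^ k * (2 ^ k * 2 ^ k))

    occurs? : ∀ X i → Dec (∃ λ x → x ∈ X × lab x ≡ i)
    occurs? X i = Fin.any? λ x → (x ∈? X) ×-dec (lab x ≟ i)

    Missed : Bool → List (Fin n) → Fin k → Set
    Missed b X i = ∃ λ a → a ∈ zs × lab a ≡ i × (∀ x → x ∈ X → adj G a x ≢ b)

    missed? : ∀ b X i → Dec (Missed b X i)
    missed? b X i = Fin.any? λ a → (a ∈? zs) ×-dec (lab a ≟ i) ×-dec
      Fin.all? (λ x → (x ∈? X) →-dec ¬? (adj G a x Bool.≟ b))

    len : List (Fin n) → Fin (suc c)
    len X with length X ≤? c
    ... | yes p = fromℕ< (s≤s p)
    -- An arbitrary value: lengths are only compared for lists of length at most `c`.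
    ... | no _ = zero

    len-injective : ∀ {X Y} → length X ≤ c → length Y ≤ c → len X ≡ len Y → length X ≡ length Y
    len-injective {X} {Y} p q e with length X ≤? c | length Y ≤? c
    ... | yes p′ | yes q′ = trans (≡-sym (Fin.toℕ-fromℕ< (s≤s p′))) (trans (cong toℕ e) (Fin.toℕ-fromℕ< (s≤s q′)))
    ... | no ¬p | _ = contradiction p ¬p
    ... | _ | no ¬q = contradiction q ¬q

    -- Equality of these label sets is enough for `Simulates`; the length is recorded too, so that
    -- thinning lengthens no list.
    key : List (Fin n) → Fin Size
    key X = combine (len X) (combine (bits (λ i → ⌊ occurs? X i ⌋))
      (combine (bits (λ i → ⌊ missed? false X i ⌋)) (bits (λ i → ⌊ missed? true X i ⌋))))

    transfer : {A B : Set} {A? : Dec A} {B? : Dec B} → ⌊ A? ⌋ ≡ ⌊ B? ⌋ → A → B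
    transfer {A? = A?} {B?} e a = ⌊⌋-true B? (trans (≡-sym e) (true⇒⌊⌋ A? a))

    key-len : ∀ {X Y} → length X ≤ c → length Y ≤ c → key X ≡ key Y → length X ≡ length Y
    key-len {X} {Y} p q e = len-injective {X} {Y} p q (proj₁ (Fin.combine-injective (len X) _ (len Y) _ e))

    key-simulates : ∀ {X Y} → key X ≡ key Y → Simulates zs lab X Y
    key-simulates {X} {Y} e = record
      { back = λ {y} y∈ → transfer {A? = occurs? Y _} {occurs? X _} (≡-sym (occ (lab y))) (y , y∈ , refl)
      ; forth = λ {x} x∈ → transfer {A? = occurs? X _} {occurs? Y _} (occ (lab x)) (x , x∈ , refl)
      ; undom = un }
      where
      e₁ = proj₂ (Fin.combine-injective (len X) _ (len Y) _ e)
      e₂ = Fin.combine-injective (bits λ i → ⌊ occurs? X i ⌋) _ (bits λ i → ⌊ occurs? Y i ⌋) _ e₁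
      e₃ = Fin.combine-injective (bits λ i → ⌊ missed? false X i ⌋) _ (bits λ i → ⌊ missed? false Y i ⌋) _ (proj₂ e₂)
      occ : ∀ i → ⌊ occurs? X i ⌋ ≡ ⌊ occurs? Y i ⌋
      occ = bits-injective (proj₁ e₂)
      mis : ∀ b i → ⌊ missed? b X i ⌋ ≡ ⌊ missed? b Y i ⌋
      mis false = bits-injective (proj₁ e₃)
      mis true = bits-injective (proj₂ e₃)
      un : ∀ b {a} → a ∈ zs → Undominated b a Y → ∃ λ a′ → a′ ∈ zs × lab a′ ≡ lab a × Undominated b a′ X
      un b {a} a∈ u =
        let (a′ , a′∈ , e′ , u′) = transfer {A? = missed? b Y _} {missed? b X _} (≡-sym (mis b (lab a)))
              (a , a∈ , refl , λ _ → u)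
        in a′ , a′∈ , e′ , λ {x} → u′ x

  -- In `complete` the list is no longer than `X`: thus lists for the two halves of `X`, taken from
  -- the children, can be joined without exceeding `c`.
  record Menu {k} (c : ℕ) (zs : List (Fin n)) (lab : Fin n → Fin k) : Set where
    field
      menu     : List (List (Fin n))
      small    : length menu ≤ menuSize k c
      short    : ∀ {Y} → Y ∈ menu → length Y ≤ c
      inside   : ∀ {Y y} → Y ∈ menu → y ∈ Y → y ∈ zs
      complete : ∀ X → length X ≤ c → (∀ {x} → x ∈ X → x ∈ zs) →
                 ∃ λ Y → Y ∈ menu × length Y ≤ length X × Simulates zs lab X Y
    marks : List (Fin n)
    marks = concat menu

  open Menu

  -- New lists are assembled only from lists of the children, which makes the marks hereditary;
  -- keeping one per key stops their number from growing with the tree.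
  module MenuUnion {k c xs ys} {f g lab : Fin n → Fin k} (cr : Cross G xs f ys g)
    (r₁ : Refines xs f lab) (r₂ : Refines ys g lab) (A : Menu c xs f) (B : Menu c ys g) where

    open Profile c (xs ++ ys) lab

    short? : (Y : List (Fin n)) → Dec (length Y ≤ c)
    short? Y = length Y ≤? c

    candidates : List (List (Fin n))
    candidates = filter short? (cartesianProductWith _++_ (A .menu) (B .menu))

    candidate⁻ : ∀ {Y} → Y ∈ candidates → length Y ≤ c ×
      ∃₂ λ Y₁ Y₂ → Y₁ ∈ A .menu × Y₂ ∈ B .menu × Y ≡ Y₁ ++ Y₂
    candidate⁻ Y∈ with ∈-filter⁻ short? {xs = cartesianProductWith _++_ (A .menu) (B .menu)} Y∈
    ... | Y∈′ , le with ∈-cartesianProductWith⁻ _++_ (A .menu) (B .menu) Y∈′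
    ...   | Y₁ , Y₂ , Y₁∈ , Y₂∈ , eq = le , Y₁ , Y₂ , Y₁∈ , Y₂∈ , eq

    thinned = thin key candidates

    inside′ : ∀ {Y y} → Y ∈ candidates → y ∈ Y → y ∈ xs ++ ys
    inside′ Y∈ y∈ with candidate⁻ Y∈
    ... | _ , Y₁ , Y₂ , Y₁∈ , Y₂∈ , refl =
      [ ∈-++⁺ˡ ∘ A .inside Y₁∈ , ∈-++⁺ʳ xs ∘ B .inside Y₂∈ ]′ (∈-++⁻ Y₁ y∈)

    complete′ : ∀ X → length X ≤ c → (∀ {x} → x ∈ X → x ∈ xs ++ ys) →
      ∃ λ Y → Y ∈ proj₁ thinned × length Y ≤ length X × Simulates (xs ++ ys) lab X Y
    complete′ X le X⊆ =
      -- Each half is simulated in its child and the results are concatenated; the list kept by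
      -- `thin` for the same key simulates the concatenation.
      let X₁ = filter in-xs? X
          X₂ = filter (¬? ∘ in-xs?) X
          split = length-split in-xs? X
          (Y₁ , Y₁∈ , le₁ , s₁) = A .complete X₁ (ℕ.≤-trans (length-filter in-xs? X) le) (proj₂ ∘ ∈-filter⁻ in-xs? {xs = X})
          (Y₂ , Y₂∈ , le₂ , s₂) = B .complete X₂ (ℕ.≤-trans (length-filter (¬? ∘ in-xs?) X) le) in-ys
          le′ = ℕ.≤-trans (ℕ.≤-reflexive (length-++ Y₁)) (ℕ.≤-trans (ℕ.+-mono-≤ le₁ le₂) (ℕ.≤-reflexive split))
          Y∈ = ∈-filter⁺ short? (∈-cartesianProductWith⁺ _++_ Y₁∈ Y₂∈) (ℕ.≤-trans le′ le)
          (Z , Z∈ , e) = proj₂ (proj₂ (proj₂ thinned)) Y∈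
          Z∈′ = proj₁ (proj₂ (proj₂ thinned)) Z∈
          eqlen = key-len {Z} {Y₁ ++ Y₂} (proj₁ (candidate⁻ Z∈′)) (ℕ.≤-trans le′ le) e
      in Z , Z∈ , ℕ.≤-trans (ℕ.≤-reflexive eqlen) le′ ,
         simulates-trans (simulates-++ cr r₁ r₂ (proj₂ ∘ ∈-filter⁻ in-xs? {xs = X}) in-ys
             (A .inside Y₁∈) (B .inside Y₂∈)
             (proj₁ ∘ ∈-filter⁻ in-xs? {xs = X}) (proj₁ ∘ ∈-filter⁻ (¬? ∘ in-xs?) {xs = X}) dichotomy s₁ s₂)
           (key-simulates {Y₁ ++ Y₂} {Z} (≡-sym e))
      where
      in-xs? = _∈? xs
      in-ys : ∀ {x} → x ∈ filter (¬? ∘ in-xs?) X → x ∈ ys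
      in-ys x∈ with ∈-filter⁻ (¬? ∘ in-xs?) {xs = X} x∈
      ... | x∈X , x∉ = [ (λ p → contradiction p x∉) , id ]′ (∈-++⁻ xs (X⊆ x∈X))
      dichotomy : ∀ {x} → x ∈ X → x ∈ filter in-xs? X ⊎ x ∈ filter (¬? ∘ in-xs?) X
      dichotomy {x} x∈ with x ∈? xs
      ... | yes p = inj₁ (∈-filter⁺ in-xs? x∈ p)
      ... | no p = inj₂ (∈-filter⁺ (¬? ∘ in-xs?) x∈ p)

    union-menu : Menu c (xs ++ ys) lab
    union-menu = record
      { menu = proj₁ thinned
      ; small = ℕ.m≤n⇒m≤1+n (proj₁ (proj₂ thinned))
      ; short = λ Y∈ → proj₁ (candidate⁻ (proj₁ (proj₂ (proj₂ thinned)) Y∈))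
      ; inside = λ Y∈ → inside′ (proj₁ (proj₂ (proj₂ thinned)) Y∈)
      ; complete = complete′ }

    hereditary : ∀ {y} → y ∈ marks union-menu → y ∈ marks A ⊎ y ∈ marks B
    hereditary y∈ with ∈-concat⁻′ (proj₁ thinned) y∈
    ... | Y , y∈Y , Y∈ with candidate⁻ (proj₁ (proj₂ (proj₂ thinned)) Y∈)
    ...   | _ , Y₁ , Y₂ , Y₁∈ , Y₂∈ , refl with ∈-++⁻ Y₁ y∈Y
    ...     | inj₁ p = inj₁ (∈-concat⁺′ p Y₁∈)
    ...     | inj₂ p = inj₂ (∈-concat⁺′ p Y₂∈)

  simulates-refl : ∀ {k zs} {lab : Fin n → Fin k} {X Y} → (∀ {x} → x ∈ X → x ∈ Y) → (∀ {x} → x ∈ Y → x ∈ X) →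
    Simulates zs lab X Y
  simulates-refl X⊆Y Y⊆X = record
    { back = λ y∈ → _ , Y⊆X y∈ , refl ; forth = λ x∈ → _ , X⊆Y x∈ , refl
    ; undom = λ b a∈ u → _ , a∈ , refl , λ x∈ → u (X⊆Y x∈) }

  menuOf : ∀ {k c xs lab} → Decomp G k xs lab → Menu (suc c) xs lab
  menuOf nil = record
    { menu = [] ∷ [] ; small = s≤s z≤n ; short = λ { (here refl) → z≤n } ; inside = λ { (here refl) () }
    ; complete = λ X _ X⊆ → [] , here refl , z≤n , simulates-refl (λ x∈ → case X⊆ x∈ of λ ()) (λ ()) }
  menuOf {k} {c} (leaf v) = record
    { menu = [] ∷ (v ∷ []) ∷ []
    ; small = s≤s (ℕ.≤-trans (ℕ.*-mono-≤ (ℕ.m^n>0 2 k) (ℕ.*-mono-≤ (ℕ.m^n>0 2 k) (ℕ.m^n>0 2 k))) (ℕ.m≤m+n _ _))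
    ; short = λ { (here refl) → z≤n ; (there (here refl)) → s≤s z≤n }
    ; inside = λ { (here refl) () ; (there (here refl)) y∈ → y∈ }
    ; complete = λ where
        [] _ _ → [] , here refl , z≤n , simulates-refl (λ ()) (λ ())
        X@(_ ∷ _) _ X⊆ → v ∷ [] , there (here refl) , s≤s z≤n ,
          simulates-refl X⊆ (λ { (here refl) → case X⊆ (here refl) of λ { (here refl) → here refl } }) }
  menuOf (node d e dis cr r₁ r₂) = MenuUnion.union-menu cr r₁ r₂ (menuOf d) (menuOf e)

  module Marks {k xs} {lab : Fin n → Fin k} (d : Decomp G k xs lab) where

    Q : List (Fin n)
    -- These menus are for lists of length up to `2 + k`, the size of the sets provided by
    -- `Domination`.
    Q = marks (menuOf {c = suc k} d)

    Q⊆ : ∀ {y} → y ∈ Q → y ∈ xs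
    Q⊆ y∈ = let (Y , y∈Y , Y∈) = ∈-concat⁻′ (menu (menuOf d)) y∈ in inside (menuOf d) Y∈ y∈Y

    Q-length : length Q ≤ menuSize k (2 + k) * (2 + k)
    Q-length = ℕ.≤-trans (length-concat≤ (menu (menuOf d)) (short (menuOf d))) (ℕ.*-monoˡ-≤ (2 + k) (small (menuOf d)))

    Q-represents : ∀ {a} → a ∈ xs → ∃ λ q → q ∈ Q × lab q ≡ lab a
    Q-represents {a} a∈ =
      let (Y , Y∈ , _ , s) = complete (menuOf {c = suc k} d) (a ∷ []) (s≤s z≤n) (λ { (here refl) → a∈ })
          (q , q∈ , e) = s .forth (here refl)
      in q , ∈-concat⁺′ q∈ Y∈ , e

    Dominates : Bool → Fin k → Fin k → Set
    Dominates b i j = ∀ {a} → a ∈ xs → lab a ≡ j → ∃ λ y → y ∈ Q × lab y ≡ i × adj G a y ≡ b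

    -- Let `Y` in the menu simulate `T`. If `Y` missed a vertex of label `j`, then `T` would miss a
    -- vertex of label `j` too, but `T` dominates those.
    Q-dominates : ∀ b i j → Domination.Dominated G {k} xs b (λ x → lab x ≡ i) (λ x → lab x ≡ j) → Dominates b i j
    Q-dominates b i j (T , len , T⊆ , dom) {a} a∈ refl
      with complete (menuOf {c = suc k} d) T len (proj₁ ∘ T⊆)
    ... | Y , Y∈ , _ , s with Fin.any? (λ y → (y ∈? Y) ×-dec (adj G a y Bool.≟ b))
    ...   | yes (y , y∈ , e) = let (t , t∈ , e′) = s .back y∈ in
            y , ∈-concat⁺′ y∈ Y∈ , trans (≡-sym e′) (proj₂ (T⊆ t∈)) , e
    ...   | no none =
            let (a′ , a′∈ , e , u) = s .undom b a∈ (λ y∈ eq → none (_ , y∈ , eq))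
                (t , t∈ , e′) = dom a′∈ e
            in contradiction e′ (u t∈)

    Q-resolves : Twin G xs lab → ∀ i j → Dominates false i j ⊎ Dominates true j i
    Q-resolves tw i j = Sum.map (Q-dominates false i j) (Q-dominates true j i)
      (Domination.dominate G {k} xs (λ x → lab x ≟ i) (λ x → lab x ≟ j) d tw)

-- Balls over atomic types

AtMostParts-≤ : ∀ {n} {L : Set} {k K} {p : Fin n → L} {X} → L → k ≤ K → AtMostParts k p X → AtMostParts K p X
AtMostParts-≤ {L = L} {k} {K} {p} {X} ℓ k≤K (f , h) = f′ , λ x Xx → let (i , e) = h x Xx in
    inject≤ i k≤K , trans e (≡-sym (f′-inject i))
  where
  f′ : Fin K → L
  f′ i with toℕ i ℕ.<? k
  ... | yes lt = f (fromℕ< lt)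
  ... | no _ = ℓ
  f′-inject : ∀ i → f′ (inject≤ i k≤K) ≡ f i
  f′-inject i with toℕ (inject≤ i k≤K) ℕ.<? k
  ... | yes lt = cong f (Fin.toℕ-injective (trans (Fin.toℕ-fromℕ< lt) (Fin.toℕ-inject≤ i k≤K)))
  ... | no ¬lt = contradiction (subst (_< k) (≡-sym (Fin.toℕ-inject≤ i k≤K)) (Fin.toℕ<n i)) ¬lt

Suffix : ∀ {A : Set} → List A → List A → Set
Suffix ws xs = ∃ λ pre → pre ++ ws ≡ xs

suffix-++ : ∀ {A : Set} {ws : List A} as {bs} → Suffix ws (as ++ bs) →
  Suffix ws bs ⊎ (∃ λ ws′ → Suffix ws′ as × ws ≡ ws′ ++ bs)
suffix-++ [] s = inj₁ s
suffix-++ (a ∷ as) ([] , refl) = inj₂ (a ∷ as , ([] , refl) , refl)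
suffix-++ (a ∷ as) (_ ∷ pre , eq) with suffix-++ as (pre , ∷-injectiveʳ eq)
... | inj₁ s = inj₁ s
... | inj₂ (ws′ , (pre′ , eq′) , eq″) = inj₂ (ws′ , (a ∷ pre′ , cong (a ∷_) eq′) , eq″)

suffix⊆ : ∀ {A : Set} {ws xs : List A} → Suffix ws xs → ∀ {u} → u ∈ ws → u ∈ xs
suffix⊆ (pre , refl) = ∈-++⁺ʳ pre

[]-suffix : ∀ {A : Set} (xs : List A) → Suffix [] xs
[]-suffix xs = xs , ++-identityʳ xs

module _ {n : ℕ} (G : Graph n) (S : Fin n → Bool) where

  private
    type = atomicTypes G S

  -- A marked vertex is alone in its type, and the types of the unmarked ones record their adjacency
  -- to it; so types determine the edges between marked and unmarked vertices.
  ball-avoids : ∀ {v y} → S v ≡ false → BallP∞ G type v y → S y ≡ false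
  ball-avoids = closedInFlip G _≟ᵗ_ (λ u → S u Bool.≟ false)
    (λ {a} _ _ ¬Sy _ ta ty → case sameType-S G S (Bool.¬-not ¬Sy) ty of λ where
      refl → sameType-adj G S (Bool.¬-not ¬Sy) ta)
    (λ _ Sa′ ¬Sy _ _ ty → case sameType-S G S (Bool.¬-not ¬Sy) ty of λ where
      refl → contradiction Sa′ ¬Sy)

  ball-marked : ∀ {v y} → S v ≡ true → BallP∞ G type v y → y ≡ v
  ball-marked {v} Sv = closedInFlip G _≟ᵗ_ (_≟ v)
    (λ where refl refl _ _ _ ty → trans (Graph.sym G _ _) (trans (sameType-adj G S Sv ty) (Graph.sym G _ _)))
    (λ where refl _ _ y′≢v ta _ → contradiction (≡-sym (sameType-S G S Sv ta)) y′≢v)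
    refl

  marked? : ∀ y → S y ≡ true ⊎ S y ≡ false
  marked? y with S y
  ... | true = inj₁ refl
  ... | false = inj₂ refl

  -- A node assigns no meaningful labels to the vertices outside it, so representing them is
  -- expressed by their adjacency to the node.
  Represented : List (Fin n) → Set
  Represented xs = ∀ {b} → b ∉ xs → ∃ λ s → S s ≡ true × s ∉ xs × (∀ {a} → a ∈ xs → adj G a b ≡ adj G a s)

  module Closed {k xs} {lab : Fin n → Fin k} (d : Decomp G k xs lab) (tw : Twin G xs lab)
    (Q⊆S : ∀ {q} → q ∈ Marks.Q G d → S q ≡ true) (rep : Represented xs) where

    open Marks G d

    C : Pred (Fin n) 0ℓ
    C u = u ∈ xs × S u ≡ false

    unmarked : ∀ {y} → S y ≡ false → ¬ C y → y ∉ xs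
    unmarked Sy ¬Cy y∈ = ¬Cy (y∈ , Sy)

    twin-mark : ∀ {a y} → a ∈ xs → y ∉ xs → ∀ {q} → q ∈ Q → lab q ≡ lab a → adj G y q ≡ adj G a y
    twin-mark a∈ y∉ q∈ e = trans (Graph.sym G _ _) (tw (Q⊆ q∈) a∈ y∉ e)

    -- A marked `s` with the adjacency of `y` leads from `a` to `a′`, since their types agree on
    -- `s`; a mark `q` with the label of `a′` then leads from `y` to `y′`.
    same-outside : ∀ {a a′ y y′} → a ∈ xs → a′ ∈ xs → y ∉ xs → y′ ∉ xs →
      type a ≡ type a′ → type y ≡ type y′ → adj G a y ≡ adj G a′ y′
    same-outside {a} {a′} {y} {y′} a∈ a′∈ y∉ y′∉ ta ty =
      let (s , Ss , _ , h) = rep y∉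
          (q , q∈ , e) = Q-represents a′∈
      in begin
        adj G a y    ≡⟨ h a∈ ⟩
        adj G a s    ≡⟨ sameType-adj G S Ss ta ⟩
        adj G a′ s   ≡⟨ h a′∈ ⟨
        adj G a′ y   ≡⟨ twin-mark a′∈ y∉ q∈ e ⟨
        adj G y q    ≡⟨ sameType-adj G S (Q⊆S q∈) ty ⟩
        adj G y′ q   ≡⟨ twin-mark a′∈ y′∉ q∈ e ⟩
        adj G a′ y′  ∎
      where open ≡-Reasoning

    -- The marks supplied by Q-resolves tell a′ from y or a from y′.
    no-conflict : ∀ {a a′ y y′} → a ∈ xs → a′ ∈ xs → y ∉ xs → y′ ∉ xs →
      type a ≡ type y′ → type y ≡ type a′ → adj G a y ≡ true → adj G a′ y′ ≡ true
    no-conflict {a} {a′} {y} {y′} a∈ a′∈ y∉ y′∉ ta ty e with Q-resolves tw (lab a) (lab a′)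
    ... | inj₁ dom = let (q , q∈ , l , f) = dom a′∈ refl in
          ⊥-elim (false≢true (trans (sameType-adj G S (Q⊆S q∈) ty) f) (trans (twin-mark a∈ y∉ q∈ l) e))
    ... | inj₂ dom = let (q , q∈ , l , t) = dom a∈ refl in
          trans (≡-sym (twin-mark a′∈ y′∉ q∈ l)) (trans (≡-sym (sameType-adj G S (Q⊆S q∈) ta)) t)

    closed : ∀ {v y} → C v → BallP∞ G type v y → C y
    closed = closedInFlip G _≟ᵗ_ (λ u → (u ∈? xs) ×-dec (S u Bool.≟ false)) same swap
      where
      same : ∀ {a a′ y y′} → C a → C a′ → ¬ C y → ¬ C y′ → type a ≡ type a′ → type y ≡ type y′ →
        adj G a y ≡ adj G a′ y′
      same {a} {a′} {y} {y′} (a∈ , _) (a′∈ , _) ¬Cy ¬Cy′ ta ty with marked? y | marked? y′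
      ... | inj₁ Sy | _ = case sameType-S G S Sy ty of λ where refl → sameType-adj G S Sy ta
      ... | inj₂ Sy | inj₁ Sy′ = case sameType-S G S Sy′ (≡-sym ty) of λ where refl → sameType-adj G S Sy′ ta
      ... | inj₂ Sy | inj₂ Sy′ = same-outside a∈ a′∈ (unmarked Sy ¬Cy) (unmarked Sy′ ¬Cy′) ta ty
      swap : ∀ {a a′ y y′} → C a → C a′ → ¬ C y → ¬ C y′ → type a ≡ type y′ → type y ≡ type a′ →
        adj G a y ≡ adj G a′ y′
      swap {a} {a′} {y} {y′} (a∈ , Sa) (a′∈ , Sa′) ¬Cy ¬Cy′ ta ty with marked? y | marked? y′
      -- A marked vertex would coincide with an unmarked vertex of the node.
      ... | inj₁ Sy | _ = case sameType-S G S Sy ty of λ where refl → ⊥-elim (false≢true Sa′ Sy)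
      ... | _ | inj₁ Sy′ = case sameType-S G S Sy′ (≡-sym ta) of λ where refl → ⊥-elim (false≢true Sa Sy′)
      ... | inj₂ Sy | inj₂ Sy′ = ⇔true⇒≡
        (no-conflict a∈ a′∈ y∉ y′∉ ta ty)
        (no-conflict a′∈ a∈ y′∉ y∉ (≡-sym ty) (≡-sym ta))
        where
        y∉ = unmarked Sy ¬Cy
        y′∉ = unmarked Sy′ ¬Cy′

  -- For an unmarked vertex of `xs`, adjacency to marked vertices outside is determined by its
  -- label, and adjacency to those inside by one bit for each entry of `T`.
  fewTypes : ∀ {k xs} {lab : Fin n → Fin k} → Twin G xs lab → ∀ T →
    (∀ {u} → u ∈ xs → S u ≡ true → u ∈ T) → ∀ {v} → S v ≡ false →
    (∀ {y} → BallP∞ G type v y → y ∈ xs) → AtMostParts (k * 2 ^ length T) type (BallP∞ G type v)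
  fewTypes {k} {xs} {lab} tw T marked {v} Sv inside =
    AtMostParts-⊆ (λ ball → inside ball , ball-avoids Sv ball)
      (codeParts (λ u → (u ∈? xs) ×-dec (S u Bool.≟ false)) v code same)
    where
    code : Fin n → Fin (k * 2 ^ length T)
    code u = combine (lab u) (bits (λ i → adj G u (lookup T i)))
    same : ∀ {x x′} → x ∈ xs × S x ≡ false → x′ ∈ xs × S x′ ≡ false → code x ≡ code x′ → type x ≡ type x′
    same {x} {x′} (x∈ , Sx) (x′∈ , Sx′) e = sameType⁺ G S Sx Sx′ agree
      where
      e₂ = Fin.combine-injective (lab x) _ (lab x′) _ e
      agree : ∀ s → S s ≡ true → adj G x s ≡ adj G x′ s
      agree s Ss with s ∈? xs
      ... | no s∉ = tw x∈ x′∈ s∉ (proj₁ e₂)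
      ... | yes s∈ = let s∈T = marked s∈ Ss in
            subst (λ t → adj G x t ≡ adj G x′ t) (≡-sym (lookup-index s∈T)) (bits-injective (proj₂ e₂) (index s∈T))

-- The order along the decomposition

markBound : ℕ → ℕ
markBound k = menuSize k (2 + k) * (2 + k)

-- The exponent bounds the marks of two children; the outer `suc` makes the bound positive, for
-- balls of a single vertex.
dmwBound : ℕ → ℕ
dmwBound k = suc (k * 2 ^ (markBound k + markBound k))

-- The marks of a node are placed before everything below it. Lists are in reverse order, so that the
-- sets of first vertices of the order are suffixes.
module Order {n k : ℕ} (G : Graph n) where

  open Marks G

  order : ∀ {xs lab} → Decomp G k xs lab → List (Fin n)
  order nil = []
  order (leaf v) = v ∷ []
  order (node d e _ _ _ _) = order e ++ order d ++ Q d ++ Q e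

  order⊆ : ∀ {xs lab} (d : Decomp G k xs lab) {u} → u ∈ order d → u ∈ xs
  order⊆ (leaf v) u∈ = u∈
  order⊆ (node {xs} d e _ _ _ _) u∈ with ∈-++⁻ (order e) u∈
  ... | inj₁ p = ∈-++⁺ʳ xs (order⊆ e p)
  ... | inj₂ p with ∈-++⁻ (order d) p
  ...   | inj₁ q = ∈-++⁺ˡ (order⊆ d q)
  ...   | inj₂ q with ∈-++⁻ (Q d) q
  ...     | inj₁ r = ∈-++⁺ˡ (Q⊆ d r)
  ...     | inj₂ r = ∈-++⁺ʳ xs (Q⊆ e r)

  order-all : ∀ {xs lab} (d : Decomp G k xs lab) {u} → u ∈ xs → u ∈ order d
  order-all (leaf v) u∈ = u∈
  order-all (node {xs} d e _ _ _ _) u∈ with ∈-++⁻ xs u∈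
  ... | inj₁ p = ∈-++⁺ʳ (order e) (∈-++⁺ˡ (order-all d p))
  ... | inj₂ p = ∈-++⁺ˡ (order-all e p)

  module _ (S : Fin n → Bool) where

    Few : Fin n → Set
    Few v = AtMostParts (dmwBound k) (atomicTypes G S) (BallP∞ G (atomicTypes G S) v)

    Inside : List (Fin n) → Set
    Inside xs = ∀ {v y} → v ∈ xs → S v ≡ false → BallP∞ G (atomicTypes G S) v y → y ∈ xs

    -- If `ws` extends beyond the marks of the children, these are all in `S`, the ball stays in the
    -- child containing `v` by `Closed`, and one descends. Otherwise `ws` lies within these marks,
    -- and so by heredity do the marks of the node itself, so that `fewTypes` applies.
    few : ∀ {xs lab} (d : Decomp G k xs lab) → Twin G xs lab → Represented G S xs → Inside xs →
      ∀ {ws} → Suffix ws (order d) → (∀ {u} → u ∈ ws → S u ≡ true) →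
      (∀ {u} → u ∈ xs → S u ≡ true → u ∈ Q d ⊎ u ∈ ws) →
      ∀ {v} → v ∈ xs → S v ≡ false → Few v
    few (leaf w) tw rep ins _ _ _ {v} (here refl) Sv = AtMostParts-≤ (atomicTypes G S w) (s≤s z≤n)
      ((λ _ → atomicTypes G S w) , λ y ball → case ins (here refl) Sv ball of λ where (here refl) → zero {0} , refl)
    few (node {xs} {ys} {f} {g} d e dis cr r₁ r₂) tw rep ins {ws} sfx ws⊆S marked {v} v∈ Sv =
      case suffix-++ (order e) sfx of λ where
        -- The right subtree comes last, so here all of `order d` has been placed; in the next case
        -- nothing of `order e` has.
        (inj₂ (we , sfxₑ , refl)) → below sfxₑ ([] , refl) (∈-++⁻ we)
          (∈-++⁺ʳ we) ∈-++⁺ˡ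
        (inj₁ sfx′) → case suffix-++ (order d) sfx′ of λ where
          (inj₂ (wd , sfx₁ , refl)) → below ([]-suffix (order e)) sfx₁ inj₂ id (λ ())
          (inj₁ sfx″) → AtMostParts-≤ (atomicTypes G S v) bound
            (fewTypes G S tw T (λ u∈ Su → [ hereditary , suffix⊆ sfx″ ]′ (marked u∈ Su)) Sv (ins v∈ Sv))
      where
      T = Q d ++ Q e
      hereditary : ∀ {u} → u ∈ Q (node d e dis cr r₁ r₂) → u ∈ T
      hereditary u∈ = [ ∈-++⁺ˡ , ∈-++⁺ʳ (Q d) ]′
        (MenuUnion.hereditary G cr r₁ r₂ (menuOf G d) (menuOf G e) u∈)
      bound : k * 2 ^ length T ≤ dmwBound k
      bound = ℕ.m≤n⇒m≤1+n (ℕ.*-monoʳ-≤ k (ℕ.^-monoʳ-≤ 2 (ℕ.≤-trans (ℕ.≤-reflexive (length-++ (Q d)))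
        (ℕ.+-mono-≤ (Q-length d) (Q-length e)))))
      Represented-ˡ : (∀ {u} → u ∈ T → S u ≡ true) → Represented G S xs
      Represented-ˡ T⊆S {b} b∉ with b ∈? ys
      ... | yes b∈ = let (q , q∈ , eq) = Q-represents e b∈ in
            q , T⊆S (∈-++⁺ʳ (Q d) q∈) , (λ q∈xs → dis q∈xs (Q⊆ e q∈)) , λ a∈ →
            cr a∈ a∈ b∈ (Q⊆ e q∈) refl (≡-sym eq)
      ... | no b∉ys = let (s , Ss , s∉ , h) = rep (++-∉ G b∉ b∉ys) in s , Ss , s∉ ∘ ∈-++⁺ˡ , h ∘ ∈-++⁺ˡ
      Represented-ʳ : (∀ {u} → u ∈ T → S u ≡ true) → Represented G S ys
      Represented-ʳ T⊆S {b} b∉ with b ∈? xs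
      ... | yes b∈ = let (q , q∈ , eq) = Q-represents d b∈ in
            q , T⊆S (∈-++⁺ˡ q∈) , (λ q∈ys → dis (Q⊆ d q∈) q∈ys) , λ a∈ →
            trans (Graph.sym G _ _) (trans (cr b∈ (Q⊆ d q∈) a∈ a∈ (≡-sym eq) refl) (Graph.sym G _ _))
      ... | no b∉xs = let (s , Ss , s∉ , h) = rep (++-∉ G b∉xs b∉) in s , Ss , s∉ ∘ ∈-++⁺ʳ xs , h ∘ ∈-++⁺ʳ xs
      below : ∀ {we wd} → Suffix we (order e) → Suffix wd (order d) →
        (∀ {u} → u ∈ ws → u ∈ we ⊎ u ∈ wd ++ T) → (∀ {u} → u ∈ wd ++ T → u ∈ ws) →
        (∀ {u} → u ∈ we → u ∈ ws) → Few v
      below {we} {wd} sfxₑ sfx₁ split wd⊆ we⊆ = case ∈-++⁻ xs v∈ of λ where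
          (inj₁ p) → few d (Twin-ˡ G cr tw r₁) (Represented-ˡ T⊆S) insˡ sfx₁ (ws⊆S ∘ wd⊆ ∘ ∈-++⁺ˡ) markedˡ p Sv
          (inj₂ p) → few e (Twin-ʳ G cr tw r₂) (Represented-ʳ T⊆S) insʳ sfxₑ (ws⊆S ∘ we⊆) markedʳ p Sv
        where
        T⊆S : ∀ {u} → u ∈ T → S u ≡ true
        T⊆S = ws⊆S ∘ wd⊆ ∘ ∈-++⁺ʳ wd
        insˡ : Inside xs
        insˡ v∈ Sv ball = proj₁ (Closed.closed G S d (Twin-ˡ G cr tw r₁) (T⊆S ∘ ∈-++⁺ˡ) (Represented-ˡ T⊆S) (v∈ , Sv) ball)
        insʳ : Inside ys
        insʳ v∈ Sv ball = proj₁ (Closed.closed G S e (Twin-ʳ G cr tw r₂) (T⊆S ∘ ∈-++⁺ʳ (Q d)) (Represented-ʳ T⊆S) (v∈ , Sv) ball)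
        located : ∀ {u} → u ∈ xs ++ ys → S u ≡ true → (u ∈ Q d ⊎ u ∈ wd) ⊎ (u ∈ Q e ⊎ u ∈ we)
        located u∈ Su with marked u∈ Su
        ... | inj₁ q = Sum.map inj₁ inj₁ (∈-++⁻ (Q d) (hereditary q))
        ... | inj₂ w with split w
        ...   | inj₁ p = inj₂ (inj₂ p)
        ...   | inj₂ p with ∈-++⁻ wd p
        ...     | inj₁ q = inj₁ (inj₂ q)
        ...     | inj₂ q = Sum.map inj₁ inj₁ (∈-++⁻ (Q d) q)
        markedˡ : ∀ {u} → u ∈ xs → S u ≡ true → u ∈ Q d ⊎ u ∈ wd
        markedˡ u∈ Su = case located (∈-++⁺ˡ u∈) Su of λ where
          (inj₁ h) → h
          (inj₂ h) → ⊥-elim (dis u∈ ([ Q⊆ e , order⊆ e ∘ suffix⊆ sfxₑ ]′ h))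
        markedʳ : ∀ {u} → u ∈ ys → S u ≡ true → u ∈ Q e ⊎ u ∈ we
        markedʳ u∈ Su = case located (∈-++⁺ʳ xs u∈) Su of λ where
          (inj₁ h) → ⊥-elim (dis ([ Q⊆ d , order⊆ d ∘ suffix⊆ sfx₁ ]′ h) u∈)
          (inj₂ h) → h

-- From lists to orders of the vertices

-- The last occurrence of an element is the one kept. Thus every tail of the result has the same
-- members as some suffix of the list, which `dedup-suffix` makes precise.
dedup : ∀ {n} → List (Fin n) → List (Fin n)
dedup [] = []
dedup (x ∷ xs) with x ∈? dedup xs
... | yes _ = dedup xs
... | no _ = x ∷ dedup xs

dedup⁺ : ∀ {n} (xs : List (Fin n)) {u} → u ∈ xs → u ∈ dedup xs
dedup⁺ (x ∷ xs) u∈ with x ∈? dedup xs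
dedup⁺ (x ∷ xs) (here refl) | yes x∈ = x∈
dedup⁺ (x ∷ xs) (there u∈) | yes _ = dedup⁺ xs u∈
dedup⁺ (x ∷ xs) (here refl) | no _ = here refl
dedup⁺ (x ∷ xs) (there u∈) | no _ = there (dedup⁺ xs u∈)

dedup⁻ : ∀ {n} (xs : List (Fin n)) {u} → u ∈ dedup xs → u ∈ xs
dedup⁻ (x ∷ xs) u∈ with x ∈? dedup xs
dedup⁻ (x ∷ xs) u∈ | yes _ = there (dedup⁻ xs u∈)
dedup⁻ (x ∷ xs) (here refl) | no _ = here refl
dedup⁻ (x ∷ xs) (there u∈) | no _ = there (dedup⁻ xs u∈)

dedup-unique : ∀ {n} (xs : List (Fin n)) → Unique (dedup xs)
dedup-unique [] = []
dedup-unique (x ∷ xs) with x ∈? dedup xs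
... | yes _ = dedup-unique xs
... | no x∉ = All.tabulate (λ { u∈ refl → x∉ u∈ }) ∷ dedup-unique xs

dedup-suffix : ∀ {n} (xs : List (Fin n)) i → ∃ λ ws → Suffix ws xs ×
  (∀ {u} → u ∈ drop i (dedup xs) → u ∈ ws) × (∀ {u} → u ∈ ws → u ∈ drop i (dedup xs))
dedup-suffix [] zero = [] , ([] , refl) , id , id
dedup-suffix [] (suc i) = [] , ([] , refl) , id , id
dedup-suffix (x ∷ xs) i with x ∈? dedup xs
... | yes _ = let (ws , (pre , eq) , to , from) = dedup-suffix xs i in ws , (x ∷ pre , cong (x ∷_) eq) , to , from
dedup-suffix (x ∷ xs) zero | no _ = x ∷ xs , ([] , refl) ,
  (λ { (here refl) → here refl ; (there p) → there (dedup⁻ xs p) }) ,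
  (λ { (here refl) → here refl ; (there p) → there (dedup⁺ xs p) })
dedup-suffix (x ∷ xs) (suc i) | no _ =
  let (ws , (pre , eq) , to , from) = dedup-suffix xs i in ws , (x ∷ pre , cong (x ∷_) eq) , to , from

lookup∈drop : ∀ {A : Set} (xs : List A) i j → i ≤ toℕ j → lookup xs j ∈ drop i xs
lookup∈drop xs zero j _ = ∈-lookup j
lookup∈drop (x ∷ xs) (suc i) (suc j) (s≤s le) = lookup∈drop xs i j le

∈drop⇒lookup : ∀ {A : Set} (xs : List A) i {u} → u ∈ drop i xs → ∃ λ j → i ≤ toℕ j × lookup xs j ≡ u
∈drop⇒lookup xs zero u∈ = index u∈ , z≤n , ≡-sym (lookup-index u∈)
∈drop⇒lookup (x ∷ xs) (suc i) u∈ = let (j , le , e) = ∈drop⇒lookup xs i u∈ in suc j , s≤s le , e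

lookup-unique : ∀ {A : Set} {xs : List A} → Unique xs → ∀ {i j} → lookup xs i ≡ lookup xs j → i ≡ j
lookup-unique (x∉ ∷ u) {zero} {zero} e = refl
lookup-unique (x∉ ∷ u) {zero} {suc j} e = contradiction e (All.lookup x∉ (∈-lookup j))
lookup-unique (x∉ ∷ u) {suc i} {zero} e = contradiction (≡-sym e) (All.lookup x∉ (∈-lookup i))
lookup-unique (x∉ ∷ u) {suc i} {suc j} e = cong suc (lookup-unique u e)

-- `drop i` leaves the last `n - i` entries, and these have to come first in the order; hence
-- positions are reversed by `opposite`.
listOrder : ∀ {n} (us : List (Fin n)) → Unique us → (∀ x → x ∈ us) → Σ (Permutation′ n) λ π →
  ∀ i u → (orderPrefix π i u ≡ true → u ∈ drop i us) × (u ∈ drop i us → orderPrefix π i u ≡ true)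
listOrder {n} us uniq all∈ = build (↔⇒≡ π₀) (λ j → lookup us j) (λ u → index (all∈ u))
    (λ u → ≡-sym (lookup-index (all∈ u))) (λ j → lookup-unique uniq (≡-sym (lookup-index (all∈ (lookup us j)))))
    (lookup∈drop us) (∈drop⇒lookup us)
  where
  π₀ : Permutation (length us) n
  π₀ = permutation (lookup us) (λ u → index (all∈ u)) (λ u → ≡-sym (lookup-index (all∈ u)))
    (λ j → lookup-unique uniq (≡-sym (lookup-index (all∈ (lookup us j)))))
  build : ∀ {s} → s ≡ n → (at : Fin s → Fin n) (pos : Fin n → Fin s) → (∀ u → at (pos u) ≡ u) →
    (∀ j → pos (at j) ≡ j) → (∀ i j → i ≤ toℕ j → at j ∈ drop i us) →
    (∀ i {u} → u ∈ drop i us → ∃ λ j → i ≤ toℕ j × at j ≡ u) → Σ (Permutation′ n) λ π →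
    ∀ i u → (orderPrefix π i u ≡ true → u ∈ drop i us) × (u ∈ drop i us → orderPrefix π i u ≡ true)
  build refl at pos at-pos pos-at to from = π , λ i u → forward i u , backward i u
    where
    π : Permutation′ n
    π = permutation (at ∘ opposite) (opposite ∘ pos)
      (λ u → trans (cong at (Fin.opposite-involutive (pos u))) (at-pos u))
      (λ j → trans (cong opposite (pos-at (opposite j))) (Fin.opposite-involutive j))
    forward : ∀ i u → orderPrefix π i u ≡ true → u ∈ drop i us
    forward i u e = subst (_∈ drop i us) (at-pos u) (to i (pos u) (ℕ.≮⇒≥ λ lt →
      ℕ.<⇒≱ (subst (_< n ∸ i) (Fin.opposite-prop (pos u)) (<ᵇ⇒<′ _ _ e)) (ℕ.∸-monoʳ-≤ n lt)))
    backward : ∀ i u → u ∈ drop i us → orderPrefix π i u ≡ true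
    backward i u u∈ with from i u∈
    ... | j , le , refl = <⇒<ᵇ′ (subst (_< n ∸ i) (≡-sym (Fin.opposite-prop (pos (at j))))
      (subst (λ p → n ∸ suc (toℕ p) < n ∸ i) (≡-sym (pos-at j)) (ℕ.∸-monoʳ-< (s≤s le) (Fin.toℕ<n j))))

Decomposable⇒DMW : ∀ {k n} {G : Graph n} → Decomposable k G → DMW∞≤ (dmwBound k) G
Decomposable⇒DMW {k} {n} {G} (xs , lab , d , all∈) = π , λ i _ _ v → small i v
  where
  open Order G
  us = dedup (order d)
  ordered = listOrder us (dedup-unique (order d)) (λ x → dedup⁺ (order d) (order-all d (all∈ x)))
  π = proj₁ ordered
  prefix = proj₂ ordered
  small : ∀ i v → Few (orderPrefix π i) v
  small i v with marked? G (orderPrefix π i) v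
  ... | inj₁ Sv = AtMostParts-≤ (atomicTypes G (orderPrefix π i) v) (s≤s z≤n)
        ((λ _ → atomicTypes G (orderPrefix π i) v) , λ y ball →
          zero {0} , cong (atomicTypes G (orderPrefix π i)) (ball-marked G (orderPrefix π i) Sv ball))
  ... | inj₂ Sv =
        let (ws , sfx , to , from) = dedup-suffix (order d) i
        -- At the root no vertex lies outside, so the invariants are trivial, and all marked
        -- vertices belong to the suffix.
        in few (orderPrefix π i) d (λ _ _ y∉ → contradiction (all∈ _) y∉) (λ b∉ → contradiction (all∈ _) b∉)
             (λ _ _ _ → all∈ _) sfx (λ u∈ → proj₂ (prefix i _) (from u∈))
             (λ {u} _ Su → inj₂ (to (proj₁ (prefix i u) Su))) (all∈ v) Sv

-- The equivalences

bounded-map : ∀ {V W : ℕ → ∀ {n} → Graph n → Set} (b : ℕ → ℕ) →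
  (∀ {k n} {G : Graph n} → V k G → W (b k) G) → ∀ {C} → Bounded V C → Bounded W C
bounded-map b f (k , h) = b k , λ n G c → f (h n G c)

PMW⇒CW : ∀ {k n} {G : Graph n} → PMW∞≤ k G → CW≤ (3 * (2 + k)) G
PMW⇒CW = Decomposable⇒CW ∘ PMW⇒Decomposable

CW⇒MW : ∀ {k n} {G : Graph n} → CW≤ k G → MW∞≤ (suc k + suc k) G
CW⇒MW = Decomposable⇒MW ∘ CW⇒Decomposable

CW⇒DMW : ∀ {k n} {G : Graph n} → CW≤ k G → DMW∞≤ (dmwBound (suc k)) G
CW⇒DMW {G = G} = Decomposable⇒DMW {G = G} ∘ CW⇒Decomposable

theorem1p2 : (C : Class) →
    (Bounded CW≤ C ⇔ Bounded MW∞≤ C) × (Bounded CW≤ C ⇔ Bounded TMW∞≤ C) ×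
    (Bounded CW≤ C ⇔ Bounded PMW∞≤ C) × (Bounded CW≤ C ⇔ Bounded DMW∞≤ C)
theorem1p2 C =
  -- Every way back to clique-width passes through `PMW∞≤`.
  mk⇔ (bounded-map _ CW⇒MW) (bounded-map _ (PMW⇒CW ∘ TMW⇒PMW ∘ MW⇒TMW)) ,
  mk⇔ (bounded-map _ (MW⇒TMW ∘ CW⇒MW)) (bounded-map _ (PMW⇒CW ∘ TMW⇒PMW)) ,
  mk⇔ (bounded-map _ (TMW⇒PMW ∘ MW⇒TMW ∘ CW⇒MW)) (bounded-map _ PMW⇒CW) ,
  mk⇔ (bounded-map _ λ {_} {_} {G} → CW⇒DMW {G = G}) (bounded-map _ λ {_} {_} {G} → PMW⇒CW ∘ DMW⇒PMW {G = G})
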